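{- For any given weighted rooted tree $L$, the proportion of weighted rooted trees of total weight $n$ that have $L$ as a limb approaches $1$ as $n\to\infty$.
   Context: A weighted rooted tree is a finite rooted tree in which each vertex is assigned a positive integer weight. Its total weight is the sum of the weights of all its vertices. Weighted rooted trees are counted up to isomorphism preserving the root and the vertex weights; there are finitely many of each total weight $n$. Let $T$ be a weighted rooted tree and $v\in V(T)$. A branch at $v$ is a weighted subtree of $T$, rooted at $v$, consisting of $v$, one child $v'$ of $v$, and all descendants of $v'$ in $T$ (so $v$ has degree $1$ in it), with weights inherited from $T$. A limb at $v$ is a weighted rooted subtree of $T$ with root $v$ that consists of a (possibly empty) collection of branches at $v$. The tree $T$ has $L$ as a limb if for some $v\in V(T)$ there is a limb at $v$ isomorphic to $L$ as a weighted rooted tree. -}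

module Defs where

open import Data.Nat.Base using (ℕ; _+_; _≥_; NonZero)
open import Data.Integer.Base using (+_)
open import Data.Rational.Base using (ℚ; 0ℚ; _/_; _-_; ∣_∣; _<_)
open import Data.Fin.Base using (Fin)
open import Data.List.Base using (List; []; _∷_; length; lookup)
open import Data.List.Relation.Unary.All using (All)
open import Data.List.Relation.Unary.Any using (Any)
open import Data.List.Relation.Unary.AllPairs using (AllPairs)
open import Data.List.Relation.Binary.Sublist.Propositional using (_⊆_)
open import Data.Product.Base using (Σ-syntax; ∃-syntax; _×_)
open import Function.Bundles using (_↔_; _⇔_; Inverse)
open import Relation.Binary.PropositionalEquality.Core using (_≡_)
open import Relation.Nullary.Negation.Core using (¬_)

-- The children are listed in some order, but that order carries no
-- information: trees are only ever compared up to _≅_ below.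
data Tree : Set where
  node : (w : ℕ) .{{_ : NonZero w}} → List Tree → Tree

mutual
  totalWeight : Tree → ℕ
  totalWeight (node w ts) = w + totalWeights ts

  totalWeights : List Tree → ℕ
  totalWeights []       = 0
  totalWeights (t ∷ ts) = totalWeight t + totalWeights ts

data Vertex : Tree → Set where
  root  : ∀ {T} → Vertex T
  below : ∀ {w} .{{_ : NonZero w}} {ts} (i : Fin (length ts)) →
          Vertex (lookup ts i) → Vertex (node w ts)

-- u ⋖ v : u is the parent of v.
data _⋖_ : ∀ {T} → Vertex T → Vertex T → Set where
  root⋖  : ∀ {w} .{{_ : NonZero w}} {ts} (i : Fin (length ts)) →
           root {node w ts} ⋖ below i root
  below⋖ : ∀ {w} .{{_ : NonZero w}} {ts} (i : Fin (length ts))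
           {u v : Vertex (lookup ts i)} →
           u ⋖ v → below {w} {ts} i u ⋖ below i v

-- v together with all its descendants.
subtree : (T : Tree) → Vertex T → Tree
subtree T           root        = T
subtree (node w ts) (below i v) = subtree (lookup ts i) v

rootWeight : Tree → ℕ
rootWeight (node w _) = w

vertexWeight : (T : Tree) → Vertex T → ℕ
vertexWeight T v = rootWeight (subtree T v)

infix 4 _⋖_ _≅_ _IsRootLimbOf_

record _≅_ (S T : Tree) : Set where
  field
    bijection : Vertex S ↔ Vertex T
  open Inverse bijection public using (to; from)
  field
    root-preserved   : to root ≡ root
    parent-preserved : ∀ u v → (u ⋖ v) ⇔ (to u ⋖ to v)
    weight-preserved : ∀ v → vertexWeight T (to v) ≡ vertexWeight S v

-- A branch at the root is the root plus one child subtree, so a collection of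
-- branches is a selection of positions in the list of children.
data _IsRootLimbOf_ : Tree → Tree → Set where
  limb : ∀ {w} .{{_ : NonZero w}} {ss ts} →
         ss ⊆ ts → node w ss IsRootLimbOf node w ts

HasLimb : Tree → Tree → Set
HasLimb T L = ∃[ v ] ∃[ M ] (M IsRootLimbOf subtree T v) × (M ≅ L)

-- There are exactly k isomorphism classes of trees satisfying P (for an
-- isomorphism-invariant P), witnessed by a list of representatives.
record CountUpToIso (P : Tree → Set) (k : ℕ) : Set where
  field
    representatives : List Tree
    satisfy         : All P representatives
    non-isomorphic  : AllPairs (λ S T → ¬ (S ≅ T)) representatives
    exhaustive      : ∀ T → P T → Any (T ≅_) representatives
    number          : length representatives ≡ k

-- a n / b n → ℓ, where b n is only required to be nonzero for large n.
RatioTendsTo : (a b : ℕ → ℕ) → ℚ → Set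
RatioTendsTo a b ℓ =
  ∀ ε → 0ℚ < ε → ∃[ N ] (∀ n → n ≥ N →
    Σ[ b≢0 ∈ NonZero (b n) ] ∣ _/_ (+ a n) (b n) {{b≢0}} - ℓ ∣ < ε)

{-# OPTIONS --safe #-}
module Submission where

open import Data.Bool.Base using (if_then_else_; true; false)
open import Data.Fin.Base using (Fin; zero; suc)
import Data.Integer.Base as ℤ
import Data.Integer.Properties as ℤ
open import Data.List.Base using (List; []; _∷_; _++_; [_]; map; concatMap; length; lookup; upTo;
  cartesianProduct; filter; deduplicate; replicate; take)
open import Data.List.Properties as List using (∷-injective; ∷-injectiveˡ; length-map; length-++;
  length-upTo; length-take; length-replicate)
open import Data.List.Membership.Propositional using (_∈_)
open import Data.List.Membership.Propositional.Properties using (∈-lookup; ∈-map⁺; ∈-map⁻; ∈-++⁺ˡ;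
  ∈-++⁺ʳ; ∈-++⁻; ∈-∃++; ∈-cartesianProduct⁺; ∈-filter⁺; ∈-filter⁻; ∈-deduplicate⁺; ∈-deduplicate⁻;
  ∈-upTo⁺; ∈-length)
open import Data.List.Relation.Binary.BagAndSetEquality using (∼bag⇒↭)
import Data.List.Relation.Binary.Lex.NonStrict as Lex
import Data.List.Relation.Binary.Permutation.Homogeneous as Homogeneous
open import Data.List.Relation.Binary.Permutation.Propositional hiding (trans)
open import Data.List.Relation.Binary.Permutation.Propositional.Properties using (map⁺; shift;
  shifts; ++⁺; ++⁺ˡ; ↭-singleton-inv; ↭-map-inv; ∈-resp-↭)
import Data.List.Relation.Binary.Permutation.Setoid
import Data.List.Relation.Binary.Permutation.Setoid.Properties
open import Data.List.Relation.Binary.Pointwise using (Pointwise; []; _∷_; Pointwise-≡⇒≡)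
open import Data.List.Relation.Binary.Sublist.Propositional using (_⊆_; []; _∷_; _∷ʳ_; ⊆-refl)
import Data.List.Relation.Binary.Sublist.Propositional.Properties as Sublist
open import Data.List.Relation.Unary.All as All using (All; []; _∷_)
import Data.List.Relation.Unary.All.Properties as All
open import Data.List.Relation.Unary.AllPairs using (AllPairs; []; _∷_)
open import Data.List.Relation.Unary.Any as Any using (Any; here; there)
open import Data.List.Relation.Unary.Any.Properties using (map↔; lookup-index)
open import Data.List.Relation.Unary.Sorted.TotalOrder.Properties using (↗↭↗⇒≋)
open import Data.List.Relation.Unary.Unique.Propositional using (Unique)
import Data.List.Relation.Unary.Unique.DecPropositional.Properties as DecUnique
import Data.List.Relation.Unary.Unique.Propositional.Properties as Unique
import Data.List.Membership.DecPropositional as DecMembership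
import Data.List.Sort
open import Data.Nat.Base hiding (_/_)
open import Data.Nat.DivMod as ℕ using (m≡m%n+[m/n]*n; m%n<n; m*n/n≡m; /-monoˡ-≤)
open import Data.Nat.ListAction using (sum)
open import Data.Nat.ListAction.Properties using (sum-↭)
open import Data.Nat.Properties
open import Data.Nat.Tactic.RingSolver using (solve-∀)
open import Data.Product.Base using (Σ-syntax; ∃-syntax; _×_; _,_; proj₁; proj₂)
open import Data.Product.Properties using (,-injectiveˡ; ,-injectiveʳ)
open import Data.Rational.Base using (mkℚ; 0ℚ; 1ℚ)
import Data.Rational.Base as ℚ
import Data.Rational.Properties as ℚ
open import Data.Rational.Unnormalised.Base as ℚᵘ using (mkℚᵘ; *≡*; *<*)
import Data.Rational.Unnormalised.Properties as ℚᵘ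
open import Data.Sum.Base using (_⊎_; inj₁; inj₂; [_,_]′)
open import Function.Base using (_∘_)
open import Function.Bundles using (_↔_; Inverse; Equivalence; mk⇔; mk↔ₛ′; mk⤖)
open import Function.Consequences.Propositional using (strictlySurjective⇒surjective)
open import Function.Properties.Bijection using (⤖⇒↔)
open import Function.Properties.Inverse using (↔-sym; ↔-trans)
open import Relation.Binary.Bundles using (DecTotalOrder; Setoid)
import Relation.Binary.Construct.On as On
open import Relation.Binary.Definitions using (DecidableEquality)
open import Relation.Binary.PropositionalEquality hiding ([_]; J)
open import Relation.Nullary
open import Relation.Nullary.Decidable using (map′; dec-true; dec-false)
open import Relation.Unary using (Decidable)
open import Relation.Unary.Properties using (∁?)
open import Defs

-- Trees avoiding L are compared with all trees of the same weight in two steps. Write l for the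
-- weight of L, and call a tree lacking if no subtree is isomorphic to L.
--
-- First, an avoiding tree that is not too light has a vertex u at which a piece of bounded weight
-- more than 3l can be cut off: part of the weight of u, or some of its branches. Put in place of
-- the piece a branch of weight l less that contains L as a limb. The new branch can be located
-- again: no subtree of the original tree is isomorphic to it, and what contains it is heavier. So
-- the avoiding trees of weight n are at most C times as many as the lacking trees of weight n − l,
-- with C independent of n.
--
-- Second, attach L as a new branch to a vertex of a lacking tree. The result, of weight n,
-- determines both the tree and the isomorphism class of the subtree at the chosen vertex, so a
-- lacking tree with K or more pairwise non-isomorphic subtrees yields K trees of weight n. A tree
-- with fewer than K such subtrees is described by fewer than K root weights and multiplicity
-- tables, so there are only polynomially many of those, whereas there are at least 2ⁿ⁻¹ trees of
-- weight n. Since K is arbitrary, the avoiding trees form a vanishing proportion.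
--
-- Isomorphism classes are represented by canonical trees, in which siblings are sorted.

-- Let t be the number of all trees of weight n, a the number of avoiding ones, and b the number of
-- lacking trees of weight n - l. Both steps insert a mark, that is, a branch not isomorphic to any
-- subtree of the original tree. Whatever properly contains the mark is heavier than it, so the mark
-- is the only occurrence of its class. Hence it can be removed again (`undo-replace`), and the
-- vertex carrying it is known up to the class of its subtree (`hosts-replace`), even if the result
-- is given only up to isomorphism.
--
-- Marks containing L as a limb give a ≤ C b (`avoiding≤codes*lacking`), where C counts the pieces
-- that `cut` may remove. Marking with L itself, at K inequivalent vertices, gives K b ≤ t + K²
-- (n+1)^(K²) for every K (`lacking*K≤`). Since t ≥ 2^(n-1) (`2^n≤trees`), it follows that K a ≤
-- (C+1) t for large n, and K is arbitrary.
--
-- Lists of trees count isomorphism classes because `canon` is a complete invariant (`canon≡⇒≅`,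
-- `≅⇒canon≡`).

children : Tree → List Tree
children (node _ ts) = ts

-- Every weight is positive, so 0 can serve as the end-of-siblings mark.
mutual
  encode : Tree → List ℕ
  encode (node w ts) = w ∷ encodes ts

  encodes : List Tree → List ℕ
  encodes []       = 0 ∷ []
  encodes (t ∷ ts) = encode t ++ encodes ts

0-not-weight : ∀ {w} .{{_ : NonZero w}} → 0 ≢ w
0-not-weight {w} 0≡w = ≢-nonZero⁻¹ w (sym 0≡w)

mutual
  -- The encoding is prefix-free: the closing 0 of each list of siblings shows where a tree ends, so
  -- a stream of numbers can be parsed in only one way.
  encode-cancel : ∀ s t {xs ys} → encode s ++ xs ≡ encode t ++ ys → s ≡ t × xs ≡ ys
  encode-cancel (node v ss) (node w ts) eq with ∷-injective eq
  ... | refl , eq′ with encodes-cancel ss ts eq′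
  ... | refl , xs≡ys = refl , xs≡ys

  encodes-cancel : ∀ ss ts {xs ys} → encodes ss ++ xs ≡ encodes ts ++ ys → ss ≡ ts × xs ≡ ys
  encodes-cancel [] [] eq = refl , proj₂ (∷-injective eq)
  encodes-cancel [] (node w _ ∷ _) eq =
    contradiction (proj₁ (∷-injective eq)) (0-not-weight {w})
  encodes-cancel (node w _ ∷ _) [] eq =
    contradiction (sym (proj₁ (∷-injective eq))) (0-not-weight {w})
  encodes-cancel (s ∷ ss) (t ∷ ts) {xs} {ys} eq
    with encode-cancel s t (trans (sym (List.++-assoc (encode s) (encodes ss) xs))
                           (trans eq (List.++-assoc (encode t) (encodes ts) ys)))
  ... | refl , eq′ with encodes-cancel ss ts eq′
  ... | refl , xs≡ys = refl , xs≡ys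

encode-injective : ∀ {s t} → encode s ≡ encode t → s ≡ t
encode-injective {s} {t} eq = proj₁ (encode-cancel s t (cong (_++ []) eq))

infix 4 _≟ᵗ_
_≟ᵗ_ : DecidableEquality Tree
s ≟ᵗ t = map′ encode-injective (cong encode) (List.≡-dec _≟_ (encode s) (encode t))

≤-treeOrder : DecTotalOrder _ _ _
≤-treeOrder = On.decTotalOrder (Lex.≤-decTotalOrder ≤-decTotalOrder) encode

open DecUnique _≟ᵗ_ using (deduplicate-!)
open DecMembership _≟ᵗ_ using (_∈?_)
open Data.List.Sort ≤-treeOrder using (sort; sort-↭; sort-↗)
open DecTotalOrder ≤-treeOrder using (totalOrder; module Eq)

-- Two sorted arrangements of one multiset agree entrywise up to the equivalence of the order, which
-- is equality of encodings and hence equality of trees.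
sort-cong : ∀ {ss ts} → ss ↭ ts → sort ss ≡ sort ts
sort-cong {ss} {ts} ss↭ts = pointwise⇒≡ (↗↭↗⇒≋ totalOrder (sort-↗ ss) (sort-↗ ts)
  (Homogeneous.map Eq.reflexive
    (↭⇒↭ₛ (↭-trans (sort-↭ ss) (↭-trans ss↭ts (↭-sym (sort-↭ ts)))))))
  where
  pointwise⇒≡ : ∀ {xs ys} → Pointwise Eq._≈_ xs ys → xs ≡ ys
  pointwise⇒≡ []       = refl
  pointwise⇒≡ (e ∷ es) = cong₂ _∷_ (encode-injective (Pointwise-≡⇒≡ e)) (pointwise⇒≡ es)

sort-singleton : ∀ t → sort [ t ] ≡ [ t ]
sort-singleton t = ↭-singleton-inv (sort-↭ [ t ])

mutual
  canon : Tree → Tree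
  canon (node w ts) = node w (sort (canons ts))

  canons : List Tree → List Tree
  canons []       = []
  canons (t ∷ ts) = canon t ∷ canons ts

canons≡map : ∀ ts → canons ts ≡ map canon ts
canons≡map []       = refl
canons≡map (t ∷ ts) = cong (canon t ∷_) (canons≡map ts)

canons-↭ : ∀ {ss ts} → ss ↭ ts → canons ss ↭ canons ts
canons-↭ {ss} {ts} p rewrite canons≡map ss | canons≡map ts = map⁺ canon p

node-cong : ∀ {v w} .{{_ : NonZero v}} .{{_ : NonZero w}} {ss ts} →
            v ≡ w → ss ≡ ts → node v ss ≡ node w ts
node-cong refl refl = refl

canon-node : ∀ {w} .{{_ : NonZero w}} {ss ts} →
             canons ss ↭ canons ts → canon (node w ss) ≡ canon (node w ts)
canon-node p = node-cong refl (sort-cong p)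

canon-node⁻¹ : ∀ S T → canon S ≡ canon T →
               rootWeight S ≡ rootWeight T × canons (children S) ↭ canons (children T)
canon-node⁻¹ (node _ ss) (node _ ts) eq =
  cong rootWeight eq ,
  ↭-trans (↭-sym (sort-↭ (canons ss)))
          (↭-trans (↭-reflexive (cong children eq)) (sort-↭ (canons ts)))

mutual
  canon-idem : ∀ t → canon (canon t) ≡ canon t
  canon-idem (node w ts) = canon-node
    (↭-trans (canons-↭ (sort-↭ (canons ts))) (↭-reflexive (canons-idem ts)))

  canons-idem : ∀ ts → canons (canons ts) ≡ canons ts
  canons-idem []       = refl
  canons-idem (t ∷ ts) = cong₂ _∷_ (canon-idem t) (canons-idem ts)

totalWeights-↭ : ∀ {ss ts} → ss ↭ ts → totalWeights ss ≡ totalWeights ts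
totalWeights-↭ refl = refl
totalWeights-↭ (prep x p) = cong (totalWeight x +_) (totalWeights-↭ p)
totalWeights-↭ (swap {xs} {ys} x y p) rewrite totalWeights-↭ p =
  trans (sym (+-assoc (totalWeight x) (totalWeight y) (totalWeights ys)))
  (trans (cong (_+ totalWeights ys) (+-comm (totalWeight x) (totalWeight y)))
    (+-assoc (totalWeight y) (totalWeight x) (totalWeights ys)))
totalWeights-↭ (_↭_.trans p q) = trans (totalWeights-↭ p) (totalWeights-↭ q)

totalWeights-++ : ∀ ss ts → totalWeights (ss ++ ts) ≡ totalWeights ss + totalWeights ts
totalWeights-++ []       ts = refl
totalWeights-++ (s ∷ ss) ts = trans (cong (totalWeight s +_) (totalWeights-++ ss ts))
  (sym (+-assoc (totalWeight s) (totalWeights ss) (totalWeights ts)))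

mutual
  totalWeight-canon : ∀ t → totalWeight (canon t) ≡ totalWeight t
  totalWeight-canon (node w ts) = cong (w +_)
    (trans (totalWeights-↭ (sort-↭ (canons ts))) (totalWeights-canons ts))

  totalWeights-canons : ∀ ts → totalWeights (canons ts) ≡ totalWeights ts
  totalWeights-canons []       = refl
  totalWeights-canons (t ∷ ts) = cong₂ _+_ (totalWeight-canon t) (totalWeights-canons ts)

-- Isomorphism is equality of canonical forms

below⋖below⁻¹ : ∀ {w} .{{_ : NonZero w}} {ts} {i j : Fin (length ts)}
                {u : Vertex (lookup ts i)} {v : Vertex (lookup ts j)} →
                below {w} {ts} i u ⋖ below j v →
                Σ[ i≡j ∈ i ≡ j ] subst (Vertex ∘ lookup ts) i≡j u ⋖ v
below⋖below⁻¹ (below⋖ _ u⋖v) = refl , u⋖v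

root⋖below⁻¹ : ∀ {w} .{{_ : NonZero w}} {ts} {j : Fin (length ts)} {v : Vertex (lookup ts j)} →
               root {node w ts} ⋖ below j v → v ≡ root
root⋖below⁻¹ (root⋖ _) = refl

below-injective : ∀ {w} .{{_ : NonZero w}} {ts} {i j : Fin (length ts)}
                  {u : Vertex (lookup ts i)} {v : Vertex (lookup ts j)} →
                  below {w} {ts} i u ≡ below j v →
                  Σ[ i≡j ∈ i ≡ j ] subst (Vertex ∘ lookup ts) i≡j u ≡ v
below-injective refl = refl , refl

module _ {S T : Tree} (f : S ≅ T) where
  open _≅_ f
  open Inverse bijection using (strictlyInverseˡ; strictlyInverseʳ)

  to-injective : ∀ {u v} → to u ≡ to v → u ≡ v
  to-injective {u} {v} eq =
    trans (sym (strictlyInverseʳ u)) (trans (cong from eq) (strictlyInverseʳ v))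

module _ {w} .(nz : NonZero w) {ss ts : List Tree}
         (σ : Fin (length ss) ↔ Fin (length ts))
         (f : ∀ i → lookup ss i ≅ lookup ts (Inverse.to σ i)) where
  private
    module σ = Inverse σ
    module f (i : Fin (length ss)) = _≅_ (f i)

    σ-injective : ∀ {i j} → σ.to i ≡ σ.to j → i ≡ j
    σ-injective {i} {j} eq =
      trans (sym (σ.strictlyInverseʳ i)) (trans (cong σ.from eq) (σ.strictlyInverseʳ j))

    φ : Vertex (node w {{nz}} ss) → Vertex (node w {{nz}} ts)
    φ root        = root
    φ (below i v) = below {{nz}} (σ.to i) (f.to i v)

    φ-injective : ∀ {u v} → φ u ≡ φ v → u ≡ v
    φ-injective {root}      {root}      _  = refl
    φ-injective {below i u} {below j v} eq with below-injective {{nz}} eq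
    ... | σi≡σj , eq′ with σ-injective σi≡σj
    ... | refl with refl ← σi≡σj = cong (below {w} {{nz}} i) (to-injective (f i) eq′)

    φ-surjective : ∀ v → ∃[ u ] φ u ≡ v
    φ-surjective root        = root , refl
    φ-surjective (below j v) with σ.from j | σ.strictlyInverseˡ j
    ... | i | refl = below {{nz}} i (f.from i v) ,
                     cong (below {w} {{nz}} j) (Inverse.strictlyInverseˡ (f.bijection i) v)

    φ-⋖ : ∀ {u v} → u ⋖ v → φ u ⋖ φ v
    φ-⋖ (root⋖ i) = subst (λ x → root ⋖ below {{nz}} (σ.to i) x) (sym (f.root-preserved i)) (root⋖ {{nz}} _)
    φ-⋖ (below⋖ i u⋖v) = below⋖ {{nz}} _ (Equivalence.to (f.parent-preserved i _ _) u⋖v)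

    φ-⋖⁻¹ : ∀ {u v} → φ u ⋖ φ v → u ⋖ v
    φ-⋖⁻¹ {root} {below i v} p
      rewrite to-injective (f i) (trans (root⋖below⁻¹ {{nz}} p) (sym (f.root-preserved i))) = root⋖ {{nz}} i
    φ-⋖⁻¹ {below i u} {below j v} p with below⋖below⁻¹ {{nz}} p
    ... | σi≡σj , p′ with σ-injective σi≡σj
    ... | refl with refl ← σi≡σj = below⋖ {{nz}} i (Equivalence.from (f.parent-preserved i _ _) p′)

    φ-weight : ∀ v → vertexWeight (node w {{nz}} ts) (φ v) ≡ vertexWeight (node w {{nz}} ss) v
    φ-weight root        = refl
    φ-weight (below i v) = f.weight-preserved i v

  node-≅ : node w {{nz}} ss ≅ node w {{nz}} ts
  node-≅ = record
    { bijection        = ⤖⇒↔ (mk⤖ (φ-injective , strictlySurjective⇒surjective φ-surjective))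
    ; root-preserved   = refl
    ; parent-preserved = λ u v → mk⇔ φ-⋖ φ-⋖⁻¹
    ; weight-preserved = φ-weight
    }

-- A permutation in this setoid carries a bijection of positions. This is how equal multisets of
-- canonical forms become a matching of the children themselves.
canonSetoid : Setoid _ _
canonSetoid = On.setoid (setoid Tree) canon

module _ where
  open Data.List.Relation.Binary.Permutation.Setoid canonSetoid
    using (onIndices) renaming (_↭_ to _↭ᶜ_)
  open Data.List.Relation.Binary.Permutation.Setoid.Properties canonSetoid
    using (onIndices-lookup)

  canons-↭⇒↭ᶜ : ∀ ss ts → canons ss ↭ canons ts → ss ↭ᶜ ts
  canons-↭⇒↭ᶜ ss ts p
    with ts′ , eq , ss↭ts′ ← ↭-map-inv canon {ss} (subst (_↭ canons ts) (canons≡map ss) p) =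
    Homogeneous.trans (Homogeneous.map (cong canon) (↭⇒↭ₛ ss↭ts′))
                      (Homogeneous.refl (pointwise ts′ ts (sym (trans (sym (canons≡map ts)) eq))))
    where
    pointwise : ∀ ss ts → map canon ss ≡ map canon ts → Pointwise (λ s t → canon s ≡ canon t) ss ts
    pointwise []       []       _  = []
    pointwise (s ∷ ss) (t ∷ ts) eq with eq₁ , eq₂ ← ∷-injective eq =
      eq₁ ∷ pointwise ss ts eq₂

  matching : ∀ {ss ts} → canons ss ↭ canons ts →
             Σ[ σ ∈ Fin (length ss) ↔ Fin (length ts) ]
               (∀ i → canon (lookup ss i) ≡ canon (lookup ts (Inverse.to σ i)))
  matching {ss} {ts} p = onIndices q , onIndices-lookup q
    where q = canons-↭⇒↭ᶜ ss ts p

mutual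
  canon≡⇒≅ : ∀ S T → canon S ≡ canon T → S ≅ T
  canon≡⇒≅ S@(node v ss) T@(node w ts) eq with canon-node⁻¹ S T eq
  ... | refl , p with matching p
  ... | σ , q = node-≅ _ σ (λ i → All.lookup (canons≡⇒≅ ss) (∈-lookup i) _ (q i))

  -- Stated for all members of the list at once to keep the recursion structural: a child reached by
  -- `lookup` is not visibly smaller than its parent.
  canons≡⇒≅ : ∀ ss → All (λ s → ∀ T → canon s ≡ canon T → s ≅ T) ss
  canons≡⇒≅ []       = []
  canons≡⇒≅ (s ∷ ss) = canon≡⇒≅ s ∷ canons≡⇒≅ ss

≅-sym : ∀ {S T} → S ≅ T → T ≅ S
≅-sym {S} {T} f = record
  { bijection        = ↔-sym bijection
  ; root-preserved   = trans (cong from (sym root-preserved)) (strictlyInverseʳ root)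
  ; parent-preserved = λ u v → mk⇔
      (λ p → Equivalence.from (parent-preserved _ _)
               (subst₂ _⋖_ (sym (strictlyInverseˡ u)) (sym (strictlyInverseˡ v)) p))
      (λ p → subst₂ _⋖_ (strictlyInverseˡ u) (strictlyInverseˡ v)
               (Equivalence.to (parent-preserved _ _) p))
  ; weight-preserved = λ v →
      trans (sym (weight-preserved (from v))) (cong (vertexWeight T) (strictlyInverseˡ v))
  }
  where
  open _≅_ f
  open Inverse bijection using (strictlyInverseˡ; strictlyInverseʳ)

-- An isomorphism knows vertices only through the root and the parent relation, so the images of
-- descendants are followed along parent steps.
data Reachable : ∀ {T} → Vertex T → Set where
  start : ∀ {T} → Reachable {T} root
  step  : ∀ {T} {u v : Vertex T} → Reachable u → u ⋖ v → Reachable v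

reachable : ∀ {T} (v : Vertex T) → Reachable v
reachable root = start
reachable (below {w} {ts} i v) = lift (reachable v)
  where
  lift : ∀ {i} {v : Vertex (lookup ts i)} → Reachable v → Reachable (below {w} {ts} i v)
  lift start      = step start (root⋖ _)
  lift (step r p) = step (lift r) (below⋖ _ p)

root⋖⁻¹ : ∀ {w} .{{_ : NonZero w}} {ts} {v : Vertex (node w ts)} → root ⋖ v →
          ∃[ i ] v ≡ below i root
root⋖⁻¹ (root⋖ i) = i , refl

below⋖⁻¹ : ∀ {w} .{{_ : NonZero w}} {ts} {i : Fin (length ts)} {u : Vertex (lookup ts i)}
           {v : Vertex (node w ts)} → below i u ⋖ v → ∃[ v′ ] v ≡ below i v′
below⋖⁻¹ (below⋖ _ _) = _ , refl

stays-below : ∀ {v w} .{{_ : NonZero v}} .{{_ : NonZero w}} {ss ts}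
              (f : node v ss ≅ node w ts) {i j} → _≅_.to f (below i root) ≡ below j root →
              ∀ {u} → Reachable u → ∃[ u′ ] _≅_.to f (below i u) ≡ below j u′
stays-below f eq start = root , eq
stays-below f eq (step r p) with u′ , eq′ ← stays-below f eq r =
  below⋖⁻¹ (subst (_⋖ _≅_.to f (below _ _)) eq′
    (Equivalence.to (_≅_.parent-preserved f _ _) (below⋖ _ p)))

-- By `stays-below`, everything below child `i` is sent below child `j`. The same holds for the
-- inverse, so the restriction is again a bijection.
child-≅ : ∀ {v w} .{{_ : NonZero v}} .{{_ : NonZero w}} {ss ts}
          (f : node v ss ≅ node w ts) {i j} →
          _≅_.to f (below i root) ≡ below j root → lookup ss i ≅ lookup ts j
child-≅ {v} {w} {ss} {ts} f {i} {j} eq = record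
  { bijection        = ⤖⇒↔ (mk⤖ (φ-injective , strictlySurjective⇒surjective φ-surjective))
  ; root-preserved   = sym (proj₂ (below-injective′ (trans (sym eq) (φ-spec root))))
  ; parent-preserved = λ x y → mk⇔
      (λ p → proj₂ (below⋖below⁻¹′ (subst₂ _⋖_ (φ-spec x) (φ-spec y)
               (Equivalence.to (parent-preserved _ _) (below⋖ i p)))))
      (λ p → proj₂ (below⋖below⁻¹′ (Equivalence.from (parent-preserved _ _)
               (subst₂ _⋖_ (sym (φ-spec x)) (sym (φ-spec y)) (below⋖ j p)))))
  ; weight-preserved = λ x →
      trans (cong (vertexWeight (node w ts)) (sym (φ-spec x))) (weight-preserved (below i x))
  }
  where
  open _≅_ f

  below-injective′ : ∀ {w} .{{_ : NonZero w}} {ts} {i : Fin (length ts)}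
                     {u v : Vertex (lookup ts i)} →
                     below {w} {ts} i u ≡ below i v → i ≡ i × u ≡ v
  below-injective′ refl = refl , refl

  below⋖below⁻¹′ : ∀ {w} .{{_ : NonZero w}} {ts} {i : Fin (length ts)}
                   {u v : Vertex (lookup ts i)} →
                   below {w} {ts} i u ⋖ below i v → i ≡ i × u ⋖ v
  below⋖below⁻¹′ (below⋖ _ p) = refl , p

  φ : Vertex (lookup ss i) → Vertex (lookup ts j)
  φ x = proj₁ (stays-below f eq (reachable x))

  φ-spec : ∀ x → to (below i x) ≡ below j (φ x)
  φ-spec x = proj₂ (stays-below f eq (reachable x))

  φ-injective : ∀ {x y} → φ x ≡ φ y → x ≡ y
  φ-injective {x} {y} e = proj₂ (below-injective′
    (to-injective f (trans (φ-spec x) (trans (cong (below j) e) (sym (φ-spec y))))))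

  φ-surjective : ∀ y → ∃[ x ] φ x ≡ y
  φ-surjective y
    with x , e ← stays-below (≅-sym f)
                   (trans (cong from (sym eq)) (Inverse.strictlyInverseʳ bijection _)) (reachable y) =
    x , proj₂ (below-injective′ (trans (sym (φ-spec x))
          (trans (cong to (sym e)) (Inverse.strictlyInverseˡ bijection _))))

children-matching : ∀ {v w} .{{_ : NonZero v}} .{{_ : NonZero w}} {ss ts}
                    (f : node v ss ≅ node w ts) →
                    Σ[ σ ∈ Fin (length ss) ↔ Fin (length ts) ]
                      (∀ i → lookup ss i ≅ lookup ts (Inverse.to σ i))
children-matching {v} {w} {ss} {ts} f =
  mk↔ₛ′ (σ f) (σ (≅-sym f)) 
    (inverse (≅-sym f) f (Inverse.strictlyInverseˡ (_≅_.bijection f)))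
    (inverse f (≅-sym f) (Inverse.strictlyInverseʳ (_≅_.bijection f))) ,
  λ i → child-≅ f (σ-spec f i)
  where
  module _ {v w} .{{_ : NonZero v}} .{{_ : NonZero w}} {ss ts} (f : node v ss ≅ node w ts) where
    open _≅_ f
    child : ∀ i → ∃[ j ] to (below i root) ≡ below j root
    child i = root⋖⁻¹ (subst (_⋖ to (below i root)) root-preserved (Equivalence.to (parent-preserved _ _) (root⋖ i)))

    σ : Fin (length ss) → Fin (length ts)
    σ i = proj₁ (child i)

    σ-spec : ∀ i → to (below i root) ≡ below (σ i) root
    σ-spec i = proj₂ (child i)

  inverse : ∀ {v w} .{{_ : NonZero v}} .{{_ : NonZero w}} {ss ts}
            (f : node v ss ≅ node w ts) (g : node w ts ≅ node v ss) →
            (∀ x → _≅_.to g (_≅_.to f x) ≡ x) → ∀ i → σ g (σ f i) ≡ i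
  inverse f g g∘f i = proj₁ (below-injective (trans (sym (σ-spec g (σ f i)))
    (trans (cong (_≅_.to g) (sym (σ-spec f i))) (g∘f (below i root)))))

Any↔lookup : ∀ {A : Set} {P : A → Set} (xs : List A) → Any P xs ↔ (∃[ i ] P (lookup xs i))
Any↔lookup {A} {P} xs = mk↔ₛ′ (λ p → Any.index p , lookup-index p) (λ (i , p) → from xs i p)
  (λ (i , p) → to∘from xs i p) from∘to
  where
  from : ∀ (xs : List A) i → P (lookup xs i) → Any P xs
  from (x ∷ xs) zero    p = here p
  from (x ∷ xs) (suc i) p = there (from xs i p)

  to∘from : ∀ xs i p → (Any.index (from xs i p) , lookup-index (from xs i p)) ≡ (i , p)
  to∘from (x ∷ xs) zero    p = refl
  to∘from (x ∷ xs) (suc i) p = cong (λ (i , p) → suc i , p) (to∘from xs i p)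

  from∘to : ∀ {xs} (p : Any P xs) → from xs (Any.index p) (lookup-index p) ≡ p
  from∘to (here p)  = refl
  from∘to (there p) = cong there (from∘to p)

-- Permutation is bag equality: for each value, the positions where it occurs on one side must
-- biject with those on the other, and `σ` provides this.
matching⇒↭ : ∀ {A B : Set} (f : A → B) {xs ys : List A} (σ : Fin (length xs) ↔ Fin (length ys)) →
             (∀ i → f (lookup xs i) ≡ f (lookup ys (Inverse.to σ i))) → map f xs ↭ map f ys
matching⇒↭ {A} {B} f {xs} {ys} σ e = ∼bag⇒↭ λ {z} →
  ↔-trans (occurrences xs) (↔-trans (reindex z) (↔-sym (occurrences ys)))
  where
  open Inverse σ
  occurrences : ∀ zs {z} → Any (z ≡_) (map f zs) ↔ (∃[ i ] z ≡ f (lookup zs i))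
  occurrences zs = ↔-trans (↔-sym map↔) (Any↔lookup zs)

  Σ-≡ : ∀ {I : Set} {g : I → B} {z} {i j : I} {p : z ≡ g i} {q : z ≡ g j} → i ≡ j →
        _≡_ {A = ∃[ i ] z ≡ g i} (i , p) (j , q)
  Σ-≡ {p = refl} {refl} refl = refl

  reindex : ∀ z → (∃[ i ] z ≡ f (lookup xs i)) ↔ (∃[ j ] z ≡ f (lookup ys j))
  reindex z = mk↔ₛ′
    (λ (i , p) → to i , trans p (e i))
    (λ (j , p) → from j , trans p (trans (cong (f ∘ lookup ys) (sym (strictlyInverseˡ j)))
                                         (sym (e (from j)))))
    (λ (j , _) → Σ-≡ (strictlyInverseˡ j))
    (λ (i , _) → Σ-≡ (strictlyInverseʳ i))

mutual
  ≅⇒canon≡ : ∀ S T → S ≅ T → canon S ≡ canon T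
  ≅⇒canon≡ (node v {{nz}} ss) (node w ts) f
    with σ , g ← children-matching f
       | refl ← trans (sym (cong (vertexWeight (node w ts)) (_≅_.root-preserved f)))
                      (_≅_.weight-preserved f root) =
    canon-node {{nz}} (subst₂ _↭_ (sym (canons≡map ss)) (sym (canons≡map ts))
      (matching⇒↭ canon σ (λ i → All.lookup (≅⇒canons≡ ss) (∈-lookup i) _ (g i))))

  ≅⇒canons≡ : ∀ ss → All (λ s → ∀ T → s ≅ T → canon s ≡ canon T) ss
  ≅⇒canons≡ []       = []
  ≅⇒canons≡ (s ∷ ss) = ≅⇒canon≡ s ∷ ≅⇒canons≡ ss

-- Having a limb is decidable and invariant under isomorphism

_≅?_ : ∀ S T → Dec (S ≅ T)
S ≅? T = map′ (canon≡⇒≅ S T) (≅⇒canon≡ S T) (canon S ≟ᵗ canon T)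

-- The predicate varies in the recursion: keeping the head changes the condition on the rest.
∃⊆? : ∀ {A : Set} {P : List A → Set} → Decidable P → Decidable (λ xs → ∃[ ys ] (ys ⊆ xs × P ys))
∃⊆? P? [] = map′ (λ p → [] , [] , p) (λ { ([] , [] , p) → p }) (P? [])
∃⊆? P? (x ∷ xs) = map′
  [ (λ (ys , s , p) → ys , x ∷ʳ s , p) , (λ (ys , s , p) → x ∷ ys , refl ∷ s , p) ]′
  (λ { (ys , _ ∷ʳ s , p) → inj₁ (ys , s , p) ; (_ ∷ ys , refl ∷ s , p) → inj₂ (ys , s , p) })
  (∃⊆? P? xs ⊎-dec ∃⊆? (λ ys → P? (x ∷ ys)) xs)

module _ (L : Tree) where
  mutual
    hasLimb? : ∀ T → Dec (HasLimb T L)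
    hasLimb? (node w ts) = map′
      [ (λ (ss , s , f) → root , node w ss , limb s , f)
      , deepen
      ]′
      (λ { (root , _ , limb s , f) → inj₁ (_ , s , f)
         ; (below i v , M , l , f) → inj₂ (at ts i (v , M , l , f)) })
      (∃⊆? (λ ss → node w ss ≅? L) ts ⊎-dec anyHasLimb? ts)
      where
      deepen : Any (λ t → HasLimb t L) ts → HasLimb (node w ts) L
      deepen a with v , M , l , f ← lookup-index a = below (Any.index a) v , M , l , f

      at : ∀ ts i → HasLimb (lookup ts i) L → Any (λ t → HasLimb t L) ts
      at (t ∷ ts) zero    h = here h
      at (t ∷ ts) (suc i) h = there (at ts i h)

    anyHasLimb? : ∀ ts → Dec (Any (λ t → HasLimb t L) ts)
    anyHasLimb? []       = no λ ()
    anyHasLimb? (t ∷ ts) = map′ Any.fromSum Any.toSum (hasLimb? t ⊎-dec anyHasLimb? ts)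

⊆-resp-↭ : ∀ {A : Set} {ws xs ys : List A} → xs ↭ ys → ws ⊆ xs → ∃[ zs ] (zs ⊆ ys × ws ↭ zs)
⊆-resp-↭ refl s = _ , s , refl
⊆-resp-↭ (prep x p) (_ ∷ʳ s) with zs , t , q ← ⊆-resp-↭ p s = zs , x ∷ʳ t , q
⊆-resp-↭ (prep x p) (refl ∷ s) with zs , t , q ← ⊆-resp-↭ p s = x ∷ zs , refl ∷ t , prep x q
⊆-resp-↭ (swap x y p) (_ ∷ʳ _ ∷ʳ s)
  with zs , t , q ← ⊆-resp-↭ p s = zs , y ∷ʳ x ∷ʳ t , q
⊆-resp-↭ (swap x y p) (_ ∷ʳ refl ∷ s)
  with zs , t , q ← ⊆-resp-↭ p s = y ∷ zs , refl ∷ x ∷ʳ t , prep y q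
⊆-resp-↭ (swap x y p) (refl ∷ _ ∷ʳ s)
  with zs , t , q ← ⊆-resp-↭ p s = x ∷ zs , y ∷ʳ refl ∷ t , prep x q
⊆-resp-↭ (swap x y p) (refl ∷ refl ∷ s)
  with zs , t , q ← ⊆-resp-↭ p s = y ∷ x ∷ zs , refl ∷ refl ∷ t , swap x y q
⊆-resp-↭ (_↭_.trans p p′) s
  with zs  , t , q  ← ⊆-resp-↭ p s
  with zs′ , t′ , q′ ← ⊆-resp-↭ p′ t = zs′ , t′ , ↭-trans q q′

canons-⊆⁺ : ∀ {ss ts} → ss ⊆ ts → canons ss ⊆ canons ts
canons-⊆⁺ {ss} {ts} s =
  subst₂ _⊆_ (sym (canons≡map ss)) (sym (canons≡map ts)) (Sublist.map⁺ canon s)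

canons-⊆⁻ : ∀ {rs} ts → rs ⊆ canons ts → ∃[ ss ] (ss ⊆ ts × rs ≡ canons ss)
canons-⊆⁻ []       []         = [] , [] , refl
canons-⊆⁻ (t ∷ ts) (_ ∷ʳ s)   with ss , s′ , eq ← canons-⊆⁻ ts s = ss , t ∷ʳ s′ , eq
canons-⊆⁻ (t ∷ ts) (refl ∷ s) with ss , s′ , eq ← canons-⊆⁻ ts s =
  t ∷ ss , refl ∷ s′ , cong (canon t ∷_) eq

rootLimb-resp : ∀ {M S T} → canon S ≡ canon T → M IsRootLimbOf S →
                ∃[ N ] (N IsRootLimbOf T × canon N ≡ canon M)
rootLimb-resp {S = S@(node w ss)} {T@(node _ ts)} eq (limb {{nz}} {ss = rs} rs⊆ss)
  with refl , p ← canon-node⁻¹ S T eq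
  with zs , zs⊆ , q ← ⊆-resp-↭ p (canons-⊆⁺ rs⊆ss)
  with us , us⊆ts , refl ← canons-⊆⁻ ts zs⊆ =
  node w {{nz}} us , limb {{nz}} us⊆ts , canon-node {{nz}} (↭-sym q)

vertex-resp : ∀ S T → canon S ≡ canon T → (v : Vertex S) →
              ∃[ u ] canon (subtree S v) ≡ canon (subtree T u)
vertex-resp S T eq root = root , eq
vertex-resp S@(node _ ss) T@(node _ ts) eq (below i v)
  with σ , e ← matching (proj₂ (canon-node⁻¹ S T eq))
  with u , eq′ ← vertex-resp (lookup ss i) _ (e i) v = below _ u , eq′

hasLimb-resp : ∀ {S T L} → canon S ≡ canon T → HasLimb S L → HasLimb T L
hasLimb-resp {S} {T} {L} eq (v , M , l , f)
  with u , eq₁ ← vertex-resp S T eq v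
  with N , l′ , eq₂ ← rootLimb-resp eq₁ l =
  u , N , l′ , canon≡⇒≅ N L (trans eq₂ (≅⇒canon≡ M L f))

-- Hereditary properties and replacement of a subtree

data Hereditarily (P : Tree → Set) : Tree → Set where
  node : ∀ {t} → P t → All (Hereditarily P) (children t) → Hereditarily P t

root-holds : ∀ {P t} → Hereditarily P t → P t
root-holds (node p _) = p

mutual
  hereditarily : ∀ {P} T → (∀ v → P (subtree T v)) → Hereditarily P T
  hereditarily (node w ts) p = node (p root) (hereditarilys ts (λ i v → p (below i v)))

  hereditarilys : ∀ {P} ts → (∀ i v → P (subtree (lookup ts i) v)) → All (Hereditarily P) ts
  hereditarilys []       p = []
  hereditarilys (t ∷ ts) p = hereditarily t (p zero) ∷ hereditarilys ts (p ∘ suc)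

-- A single occurrence is replaced. The derivation is the path from the root to the site, along
-- which the later proofs recurse.
data Replace (S S′ : Tree) : Tree → Tree → Set where
  here  : Replace S S′ S S′
  there : ∀ {w} .{{_ : NonZero w}} us {t t′} vs → Replace S S′ t t′ →
          Replace S S′ (node w (us ++ t ∷ vs)) (node w (us ++ t′ ∷ vs))

split-at : ∀ {A : Set} (xs : List A) i → ∃[ us ] ∃[ vs ] xs ≡ us ++ lookup xs i ∷ vs
split-at (x ∷ xs) zero = [] , xs , refl
split-at (x ∷ xs) (suc i) with us , vs , eq ← split-at xs i = x ∷ us , vs , cong (x ∷_) eq

replaceAt : ∀ {T} (v : Vertex T) S′ → ∃[ T′ ] Replace (subtree T v) S′ T T′
replaceAt root S′ = S′ , here
replaceAt (below {w} {ts} i v) S′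
  with us , vs , eq ← split-at ts i | T′ , r ← replaceAt v S′ =
  node w (us ++ T′ ∷ vs) ,
  subst (λ xs → Replace _ S′ (node w xs) (node w (us ++ T′ ∷ vs))) (sym eq) (there us vs r)

totalWeights-insert : ∀ us t vs →
  totalWeights (us ++ t ∷ vs) ≡ totalWeight t + (totalWeights us + totalWeights vs)
totalWeights-insert us t vs =
  trans (totalWeights-↭ (shift t us vs)) (cong (totalWeight t +_) (totalWeights-++ us vs))

-- The witness `c` is the weight outside the replaced subtree.
replace-weight : ∀ {S S′ T T′} → Replace S S′ T T′ →
  ∃[ c ] (totalWeight T ≡ totalWeight S + c × totalWeight T′ ≡ totalWeight S′ + c)
replace-weight here = 0 , sym (+-identityʳ _) , sym (+-identityʳ _)
replace-weight (there {w} us {t} {t′} vs r) with c , e , e′ ← replace-weight r =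
  w + (c + d) , enclose e , enclose e′
  where
  d = totalWeights us + totalWeights vs
  enclose : ∀ {s t} → totalWeight t ≡ s + c → w + totalWeights (us ++ t ∷ vs) ≡ s + (w + (c + d))
  enclose {s} {t} e = begin
    w + totalWeights (us ++ t ∷ vs) ≡⟨ cong (w +_) (totalWeights-insert us t vs) ⟩
    w + (totalWeight t + d)         ≡⟨ cong (λ x → w + (x + d)) e ⟩
    w + (s + c + d)                 ≡⟨ cong (w +_) (+-assoc s c d) ⟩
    w + (s + (c + d))               ≡⟨ +-assoc w s (c + d) ⟨
    w + s + (c + d)                 ≡⟨ cong (_+ (c + d)) (+-comm w s) ⟩
    s + w + (c + d)                 ≡⟨ +-assoc s w (c + d) ⟩
    s + (w + (c + d))               ∎
    where open ≡-Reasoning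

replace-grows : ∀ {S S′ T T′} → Replace S S′ T T′ → totalWeight S′ ≤ totalWeight T′
replace-grows r with c , _ , e ← replace-weight r = subst (_ ≤_) (sym e) (m≤m+n _ c)

-- Recognising and removing a mark

nonZero-+ : ∀ w e .{{_ : NonZero w}} → NonZero (w + e)
nonZero-+ zero    e = contradiction refl (≢-nonZero⁻¹ 0)
nonZero-+ (suc w) e = _

concatMap-↭ : ∀ {A B : Set} (f : A → List B) {xs ys} → xs ↭ ys → concatMap f xs ↭ concatMap f ys
concatMap-↭ f refl         = refl
concatMap-↭ f (prep x p)   = ++⁺ˡ (f x) (concatMap-↭ f p)
concatMap-↭ f (swap x y p) =
  ↭-trans (shifts (f x) (f y)) (++⁺ˡ (f y) (++⁺ˡ (f x) (concatMap-↭ f p)))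
concatMap-↭ f (_↭_.trans p q) = ↭-trans (concatMap-↭ f p) (concatMap-↭ f q)

canons-++ : ∀ ss ts → canons (ss ++ ts) ≡ canons ss ++ canons ts
canons-++ []       ts = refl
canons-++ (s ∷ ss) ts = cong (canon s ∷_) (canons-++ ss ts)

module _ (m : Tree) where

  Missing : Tree → Set
  Missing = Hereditarily (λ t → canon t ≢ m)

  mutual
    light⇒missing : ∀ t → totalWeight t < totalWeight m → Missing t
    light⇒missing t@(node w ts) t<m = node
      (λ eq → <-irrefl (trans (sym (totalWeight-canon t)) (cong totalWeight eq)) t<m)
      (lights⇒missing ts (≤-<-trans (m≤n+m _ w) t<m))

    lights⇒missing : ∀ ts → totalWeights ts < totalWeight m → All Missing ts
    lights⇒missing []       _    = []
    lights⇒missing (t ∷ ts) ts<m =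
      light⇒missing t (≤-<-trans (m≤m+n _ _) ts<m) ∷
      lights⇒missing ts (≤-<-trans (m≤n+m _ (totalWeight t)) ts<m)

  heavy⇒≢ : ∀ t → totalWeight m < totalWeight t → canon t ≢ m
  heavy⇒≢ t m<t eq = <-irrefl (trans (cong totalWeight (sym eq)) (totalWeight-canon t)) m<t

  -- Outside the new subtree, only the subtrees at the ancestors of the site change. These contain
  -- `S′`, so they are too heavy to be `m`.
  replace-missing : ∀ {S S′ T T′} → Replace S S′ T T′ → totalWeight m < totalWeight S′ →
                    (Missing S → Missing S′) → Missing T → Missing T′
  replace-missing here m<S′ f p = f p
  replace-missing r@(there us {t} {t′} vs q) m<S′ f (node _ ps) with All.++⁻ us ps
  ... | ps₁ , p ∷ ps₂ = node (heavy⇒≢ _ (<-≤-trans m<S′ (replace-grows r)))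
                             (All.++⁺ ps₁ (replace-missing q m<S′ f p ∷ ps₂))

  -- A branch of class `m` is read as a mark standing for a weight `δ` and branches `fs` that were
  -- cut off at the parent; `undo` gives them back. It is defined for any number of marks but is of
  -- interest for trees with exactly one.
  module Undo (δ : ℕ) (fs : List Tree) where

    excess : Tree → ℕ
    excess t = if does (canon t ≟ᵗ m) then δ else 0

    mutual
      undo : Tree → Tree
      undo (node w ts) = node (w + sum (map excess ts)) {{nonZero-+ w _}} (undos ts)

      undos : List Tree → List Tree
      undos []       = []
      undos (t ∷ ts) = (if does (canon t ≟ᵗ m) then fs else [ undo t ]) ++ undos ts

    undos≡concatMap : ∀ ts →
      undos ts ≡ concatMap (λ t → if does (canon t ≟ᵗ m) then fs else [ undo t ]) ts
    undos≡concatMap []       = refl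
    undos≡concatMap (t ∷ ts) = cong (_ ++_) (undos≡concatMap ts)

    undos-++ : ∀ ss ts → undos (ss ++ ts) ≡ undos ss ++ undos ts
    undos-++ []       ts = refl
    undos-++ (s ∷ ss) ts = trans (cong (_ ++_) (undos-++ ss ts)) (sym (List.++-assoc _ (undos ss) (undos ts)))

    undos-↭ : ∀ {ss ts} → ss ↭ ts → undos ss ↭ undos ts
    undos-↭ {ss} {ts} p rewrite undos≡concatMap ss | undos≡concatMap ts = concatMap-↭ _ p

    excess-canons : ∀ ts → map excess (canons ts) ≡ map excess ts
    excess-canons []       = refl
    excess-canons (t ∷ ts) rewrite canon-idem t = cong (_ ∷_) (excess-canons ts)

    mutual
      -- Undoing is well defined on isomorphism classes, so a marked tree can be decoded from its
      -- canonical form.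
      canon-undo : ∀ t → canon (undo (canon t)) ≡ canon (undo t)
      canon-undo (node w ts) = node-cong {{nonZero-+ w _}} {{nonZero-+ w _}}
        (cong (w +_) (trans (sum-↭ (map⁺ excess (sort-↭ (canons ts)))) (cong sum (excess-canons ts))))
        (sort-cong (↭-trans (canons-↭ (undos-↭ (sort-↭ (canons ts)))) (↭-reflexive (canons-undos ts))))

      canons-undos : ∀ ts → canons (undos (canons ts)) ≡ canons (undos ts)
      canons-undos [] = refl
      canons-undos (t ∷ ts) rewrite canon-idem t with does (canon t ≟ᵗ m)
      ... | true  = trans (canons-++ fs _) (trans (cong (canons fs ++_) (canons-undos ts))
                      (sym (canons-++ fs _)))
      ... | false = cong₂ _∷_ (canon-undo t) (canons-undos ts)

    mutual
      undo-missing : ∀ {t} → Missing t → undo t ≡ t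
      undo-missing {node w _} (node _ ps) =
        node-cong {{nonZero-+ w _}} (trans (cong (w +_) (excess-missing ps)) (+-identityʳ w)) (undos-missing ps)

      undos-missing : ∀ {ts} → All Missing ts → undos ts ≡ ts
      undos-missing [] = refl
      undos-missing (_∷_ {t} p ps)
        rewrite dec-false (canon t ≟ᵗ m) (root-holds p) = cong₂ _∷_ (undo-missing p) (undos-missing ps)

      excess-missing : ∀ {ts} → All Missing ts → sum (map excess ts) ≡ 0
      excess-missing [] = refl
      excess-missing (_∷_ {t} p ps)
        rewrite dec-false (canon t ≟ᵗ m) (root-holds p) = excess-missing ps

    undo-marker : ∀ {w} .{{_ : NonZero w}} {M ts} → canon M ≡ m → All Missing ts →
                  undo (node w (M ∷ ts)) ≡ node (w + δ) {{nonZero-+ w δ}} (fs ++ ts)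
    undo-marker {w} {M = M} eq ps rewrite dec-true (canon M ≟ᵗ m) eq =
      node-cong {{nonZero-+ w _}} {{nonZero-+ w δ}}
        (cong (w +_) (trans (cong (δ +_) (excess-missing ps)) (+-identityʳ δ)))
        (cong (fs ++_) (undos-missing ps))

    -- Off the path to the site nothing is of class `m`, and on the path everything is heavier than
    -- `m`. So `undo` acts only inside `S′`.
    undo-replace : ∀ {S S′ T T′} → Replace S S′ T T′ → totalWeight m < totalWeight S′ →
                   (Missing S → undo S′ ≡ S) → Missing T → undo T′ ≡ T
    undo-replace here m<S′ f p = f p
    undo-replace (there {w} us {t} {t′} vs r) m<S′ f (node _ ps) with All.++⁻ us ps
    ... | ps₁ , p ∷ ps₂ = node-cong {{nonZero-+ w _}}
      (trans (cong (w +_) no-excess) (+-identityʳ w))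
      (trans (undos-++ us (t′ ∷ vs)) (cong₂ _++_ (undos-missing ps₁) tail))
      where
      t′≢m = heavy⇒≢ t′ (<-≤-trans m<S′ (replace-grows r))

      tail : undos (t′ ∷ vs) ≡ t ∷ vs
      tail rewrite dec-false (canon t′ ≟ᵗ m) t′≢m =
        cong₂ _∷_ (undo-replace r m<S′ f p) (undos-missing ps₂)

      no-excess : sum (map excess (us ++ t′ ∷ vs)) ≡ 0
      no-excess = trans (sum-↭ (map⁺ excess (shift t′ us vs))) lemma
        where
        lemma : sum (map excess (t′ ∷ us ++ vs)) ≡ 0
        lemma rewrite dec-false (canon t′ ≟ᵗ m) t′≢m = excess-missing (All.++⁺ ps₁ ps₂)

  mutual
    -- Records where the marks hang, once for each mark. In an unordered tree a position is only
    -- meaningful through the class of the subtree there, so that is what is listed.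
    hosts : Tree → List Tree
    hosts t@(node w ts) = hostsAmong (canon t) ts

    hostsAmong : Tree → List Tree → List Tree
    hostsAmong p []       = []
    hostsAmong p (t ∷ ts) = ((if does (canon t ≟ᵗ m) then [ p ] else []) ++ hosts t) ++ hostsAmong p ts

  hostsAmong≡concatMap : ∀ p ts →
    hostsAmong p ts ≡ concatMap (λ t → (if does (canon t ≟ᵗ m) then [ p ] else []) ++ hosts t) ts
  hostsAmong≡concatMap p []       = refl
  hostsAmong≡concatMap p (t ∷ ts) = cong (_ ++_) (hostsAmong≡concatMap p ts)

  hostsAmong-↭ : ∀ p {ss ts} → ss ↭ ts → hostsAmong p ss ↭ hostsAmong p ts
  hostsAmong-↭ p {ss} {ts} q rewrite hostsAmong≡concatMap p ss | hostsAmong≡concatMap p ts = concatMap-↭ _ q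

  mutual
    hosts-canon : ∀ t → hosts (canon t) ↭ hosts t
    hosts-canon t@(node w ts) rewrite canon-idem t =
      ↭-trans (hostsAmong-↭ (canon t) (sort-↭ (canons ts))) (hostsAmong-canons (canon t) ts)

    hostsAmong-canons : ∀ p ts → hostsAmong p (canons ts) ↭ hostsAmong p ts
    hostsAmong-canons p []       = refl
    hostsAmong-canons p (t ∷ ts) rewrite canon-idem t =
      ++⁺ (++⁺ˡ (if does (canon t ≟ᵗ m) then [ p ] else []) (hosts-canon t)) (hostsAmong-canons p ts)

  hostsAmong-++ : ∀ p ss ts → hostsAmong p (ss ++ ts) ≡ hostsAmong p ss ++ hostsAmong p ts
  hostsAmong-++ p []       ts = refl
  hostsAmong-++ p (s ∷ ss) ts = trans (cong (_ ++_) (hostsAmong-++ p ss ts)) (sym (List.++-assoc _ (hostsAmong p ss) (hostsAmong p ts)))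

  mutual
    hosts-missing : ∀ {t} → Missing t → hosts t ≡ []
    hosts-missing {node _ _} (node _ ps) = hostsAmong-missing ps

    hostsAmong-missing : ∀ {p ts} → All Missing ts → hostsAmong p ts ≡ []
    hostsAmong-missing [] = refl
    hostsAmong-missing (_∷_ {t} q qs) rewrite dec-false (canon t ≟ᵗ m) (root-holds q) = cong₂ _++_ (hosts-missing q) (hostsAmong-missing qs)

  hosts-marker : ∀ {w} .{{_ : NonZero w}} {M ts} → canon M ≡ m → All Missing ts →
                 hosts (node w (M ∷ ts)) ≡ [ canon (node w (M ∷ ts)) ]
  hosts-marker {M = M@(node v ms)} eq ps rewrite dec-true (canon M ≟ᵗ m) eq =
    -- The mark hides no further mark, since everything below its root is lighter than `m`.
    cong (_ ∷_) (cong₂ _++_ (hostsAmong-missing (lights⇒missing ms ms<m)) (hostsAmong-missing ps))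
    where
    ms<m : totalWeights ms < totalWeight m
    ms<m = subst (totalWeights ms <_) (trans (sym (totalWeight-canon M)) (cong totalWeight eq))
      (m<n+m _ (>-nonZero⁻¹ v))

  hosts-replace : ∀ {S S′ T T′} → Replace S S′ T T′ → totalWeight m < totalWeight S′ →
                  (Missing S → hosts S′ ≡ [ canon S′ ]) → Missing T → hosts T′ ≡ [ canon S′ ]
  hosts-replace here m<S′ f p = f p
  hosts-replace (there us {t} {t′} vs r) m<S′ f (node _ ps) with All.++⁻ us ps
  ... | ps₁ , p ∷ ps₂
    rewrite hostsAmong-++ (canon (node _ (us ++ t′ ∷ vs))) us (t′ ∷ vs)
          | hostsAmong-missing {canon (node _ (us ++ t′ ∷ vs))} ps₁
          | dec-false (canon t′ ≟ᵗ m) (heavy⇒≢ t′ (<-≤-trans m<S′ (replace-grows r)))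
          | hosts-replace r m<S′ f p
          | hostsAmong-missing {canon (node _ (us ++ t′ ∷ vs))} ps₂ = refl

-- Trading a piece of an avoiding tree for a marker

hasLimb-refl : ∀ L → HasLimb L L
hasLimb-refl L@(node w ls) = root , L , limb ⊆-refl , canon≡⇒≅ L L refl

hasLimb-subtree : ∀ T v {L} → HasLimb (subtree T v) L → HasLimb T L
hasLimb-subtree T root h = h
hasLimb-subtree (node w {{nz}} ts) (below i v) h
  with u , r ← hasLimb-subtree (lookup ts i) v h = below {{nz}} i u , r

-- Greedy choice: trees are taken until their weight reaches `j`, so the excess `k` is less than the
-- weight of the last tree taken, or is 0 if none is.
prefix : ∀ j b ts → 0 < b → All (λ t → totalWeight t < b) ts → j ≤ totalWeights ts →
         ∃[ fs ] ∃[ rest ] ∃[ k ] ts ≡ fs ++ rest × totalWeights fs ≡ j + k × k < b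
prefix zero b ts 0<b _ _ = [] , ts , 0 , refl , refl , 0<b
prefix (suc j) b (t ∷ ts) 0<b (t<b ∷ ts<b) j≤ with suc j ≤? totalWeight t
... | yes j≤t = [ t ] , ts , totalWeight t ∸ suc j , refl ,
  trans (+-identityʳ _) (sym (m+[n∸m]≡n j≤t)) , ≤-<-trans (m∸n≤m _ (suc j)) t<b
... | no j≰t
  with t≤j ← ≰⇒≥ j≰t
  with fs , rest , k , refl , eq , k<b ←
    prefix (suc j ∸ totalWeight t) b ts 0<b ts<b (m≤n+o⇒m∸n≤o (suc j) (totalWeight t) j≤) =
  t ∷ fs , rest , k , refl ,
  trans (cong (totalWeight t +_) eq)
        (trans (sym (+-assoc (totalWeight t) _ k)) (cong (_+ k) (m+[n∸m]≡n t≤j))) ,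
  k<b

module _ (J : ℕ) (0<J : 0 < J) where

  -- At the root, weight j + k with k < 2 j can be taken either from the root weight alone (δ) or
  -- from a collection of children alone (fs).
  record Cut (T : Tree) : Set where
    field
      k δ w   : ℕ
      {{nz}}  : NonZero w
      fs rest : List Tree
      site    : Vertex T
      decomposition : subtree T site ≡ node (w + δ) {{nonZero-+ w δ}} (fs ++ rest)
      removed : δ + totalWeights fs ≡ J + k
      k<2J    : k < J + J

  mutual
    -- Descend while some child subtree weighs at least 2 `J`. At the last vertex all child subtrees
    -- are lighter than that. If the vertex weighs more than `J`, take `J` from it, leaving a
    -- positive weight; otherwise its branches contribute at least `J`, and `prefix` selects some of
    -- them.
    cut : ∀ T → J + J ≤ totalWeight T → Cut T
    cut (node w {{nz}} ts) heavy with cuts ts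
    ... | inj₁ (i , c) = record { Cut c ; site = below i (Cut.site c) }
    ... | inj₂ light with J <? w
    ... | yes J<w = record
      { k = 0 ; δ = J ; w = w ∸ J ; nz = >-nonZero (m<n⇒0<n∸m J<w) ; fs = [] ; rest = ts ; site = root
      ; decomposition = node-cong {{_}} {{nonZero-+ (w ∸ J) J {{>-nonZero (m<n⇒0<n∸m J<w)}}}}
          (sym (m∸n+n≡m (<⇒≤ J<w))) refl
      ; removed = refl
      ; k<2J = <-≤-trans 0<J (m≤m+n J J) }
    ... | no J≮w
      with fs , rest , k , refl , eq , k<2J ← prefix J (J + J) ts (<-≤-trans 0<J (m≤m+n J J)) light
             (+-cancelˡ-≤ w J (totalWeights ts) (≤-trans (+-monoˡ-≤ J (≮⇒≥ J≮w)) heavy)) = record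
      { k = k ; δ = 0 ; w = w ; nz = >-nonZero (>-nonZero⁻¹ w {{nz}}) ; fs = fs ; rest = rest ; site = root
      ; decomposition = node-cong {{_}} {{nonZero-+ w 0 {{nz}}}} (sym (+-identityʳ w)) refl
      ; removed = eq
      ; k<2J = k<2J }

    cuts : ∀ ts → (∃[ i ] Cut (lookup ts i)) ⊎ All (λ t → totalWeight t < J + J) ts
    cuts [] = inj₂ []
    cuts (t ∷ ts) with J + J ≤? totalWeight t
    ... | yes heavy = inj₁ (zero , cut t heavy)
    ... | no ¬heavy with cuts ts
    ... | inj₁ (i , c) = inj₁ (suc i , c)
    ... | inj₂ light   = inj₂ (≰⇒> ¬heavy ∷ light)

module Marking (w₀ : ℕ) .{{_ : NonZero w₀}} (ls : List Tree) where

  private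
    L : Tree
    L = node w₀ ls

    l : ℕ
    l = totalWeight L

  -- L is a limb of marker k but, as the extra leaf is heavier than L, not a subtree of it.
  marker : ℕ → Tree
  marker k = node w₀ (node (suc l + k) [] ∷ ls)

  -- Trading a piece of weight J + k for marker k frees exactly l.
  J : ℕ
  J = suc (l + l + l)

  0<J : 0 < J
  0<J = z<s

  marker-weight : ∀ k → totalWeight (marker k) ≡ suc (l + l + k)
  marker-weight k = lemma w₀ l k (totalWeights ls)
    where
    lemma : ∀ w l k r → w + ((suc l + k) + 0 + r) ≡ suc (l + (w + r) + k)
    lemma = solve-∀

  l<marker : ∀ k → l < totalWeight (marker k)
  l<marker k rewrite marker-weight k = s≤s (≤-trans (m≤m+n l l) (m≤m+n (l + l) k))

  -- The whole marker and its extra leaf are heavier than `L`, while the trees in `ls` are lighter.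
  marker-missing : ∀ k → Missing (canon L) (marker k)
  marker-missing k = node (heavy⇒≢ (canon L) (marker k) (subst (_< totalWeight (marker k)) (sym L≡l) (l<marker k)))
    (node (heavy⇒≢ (canon L) (node (suc l + k) [])
       (subst (_< suc (l + k) + 0) (sym L≡l) (s≤s (≤-trans (m≤m+n l k) (m≤m+n (l + k) 0))))) [] ∷
     lights⇒missing (canon L) ls (subst (totalWeights ls <_) (sym L≡l) (m<n+m _ (>-nonZero⁻¹ w₀))))
    where
    L≡l : totalWeight (canon L) ≡ l
    L≡l = totalWeight-canon L

  -- What is needed to undo a marking: the index of the marker, then the weight and the branches
  -- that it replaced.
  Code : Set
  Code = ℕ × ℕ × List Tree

  unmark : Code → Tree → Tree
  unmark (k , δ , fs) = Undo.undo (canon (marker k)) δ fs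

  -- Applied twice to an avoiding tree: with `M` = `L` it makes the marked tree lacking, and with
  -- `M` a marker it makes the marking reversible.
  avoids⇒missing : ∀ T M → ¬ HasLimb T L → HasLimb M L → Missing (canon M) T
  avoids⇒missing T M avoids h =
    hereditarily T λ v eq → avoids (hasLimb-subtree T v (hasLimb-resp (sym eq) h))

  marker-hasLimb : ∀ k → HasLimb (marker k) L
  marker-hasLimb k = root , L , limb (_ ∷ʳ ⊆-refl) , canon≡⇒≅ L L refl

  record Marked (T : Tree) : Set where
    field
      k δ      : ℕ
      fs       : List Tree
      tree     : Tree
      removed  : δ + totalWeights fs ≡ J + k
      k<2J     : k < J + J
      missing  : Missing (canon L) tree
      weight   : totalWeight T ≡ totalWeight tree + l
      recovers : unmark (k , δ , fs) tree ≡ T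

  mark : ∀ T → ¬ HasLimb T L → J + J ≤ totalWeight T → Marked T
  mark T avoids heavy = record
    { k = k ; δ = δ ; fs = fs ; tree = proj₁ T↦T′ ; removed = removed ; k<2J = k<2J
    ; missing = replace-missing (canon L) (proj₂ T↦T′)
        (subst (_< totalWeight S′) (sym (totalWeight-canon L)) l<S′)
        (λ p → node (heavy⇒≢ (canon L) S′ (subst (_< totalWeight S′) (sym (totalWeight-canon L)) l<S′))
                    (marker-missing k ∷ All.++⁻ʳ fs (below-missing p)))
        (avoids⇒missing T L avoids (hasLimb-refl L))
    ; weight = T≡T′+l
    ; recovers = Undo.undo-replace (canon (marker k)) δ fs (proj₂ T↦T′)
        (subst (_< totalWeight S′) (sym (totalWeight-canon (marker k))) marker<S′)
        (λ p → trans (Undo.undo-marker (canon (marker k)) δ fs {{nz}} refl (All.++⁻ʳ fs (below-missing p)))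
                     (sym decomposition))
        (avoids⇒missing T (marker k) avoids (marker-hasLimb k))
    }
    where
    open Cut (cut J 0<J T heavy)
    S = subtree T site
    S′ = node w {{nz}} (marker k ∷ rest)
    T↦T′ = replaceAt site S′

    marker<S′ : totalWeight (marker k) < totalWeight S′
    marker<S′ = <-≤-trans (m<n+m _ (>-nonZero⁻¹ w {{nz}})) (+-monoʳ-≤ w (m≤m+n _ _))

    l<S′ : l < totalWeight S′
    l<S′ = <-trans (l<marker k) marker<S′

    below-missing : ∀ {P} → Hereditarily P S → All (Hereditarily P) (fs ++ rest)
    below-missing p with node _ ps ← subst (Hereditarily _) decomposition p = ps

    S≡S′+l : totalWeight S ≡ totalWeight S′ + l
    S≡S′+l = begin
      totalWeight S                                            ≡⟨ cong totalWeight decomposition ⟩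
      w + δ + totalWeights (fs ++ rest)                        ≡⟨ cong (w + δ +_) (totalWeights-++ fs rest) ⟩
      w + δ + (totalWeights fs + totalWeights rest)            ≡⟨ regroup w δ (totalWeights fs) (totalWeights rest) ⟩
      w + (δ + totalWeights fs) + totalWeights rest            ≡⟨ cong (λ x → w + x + totalWeights rest) removed ⟩
      w + (J + k) + totalWeights rest                          ≡⟨ balance w l k (totalWeights rest) ⟩
      w + (suc (l + l + k) + totalWeights rest) + l            ≡⟨ cong (λ x → w + (x + totalWeights rest) + l) (marker-weight k) ⟨
      totalWeight S′ + l                                       ∎
      where
      open ≡-Reasoning
      regroup : ∀ w δ f r → w + δ + (f + r) ≡ w + (δ + f) + r
      regroup = solve-∀
      balance : ∀ w l k r → w + (suc (l + l + l) + k) + r ≡ w + (suc (l + l + k) + r) + l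
      balance = solve-∀

    T≡T′+l : totalWeight T ≡ totalWeight (proj₁ T↦T′) + l
    T≡T′+l with c , eq , eq′ ← replace-weight (proj₂ T↦T′) = begin
      totalWeight T                   ≡⟨ eq ⟩
      totalWeight S + c               ≡⟨ cong (_+ c) S≡S′+l ⟩
      totalWeight S′ + l + c          ≡⟨ swapʳ (totalWeight S′) l c ⟩
      totalWeight S′ + c + l          ≡⟨ cong (_+ l) eq′ ⟨
      totalWeight (proj₁ T↦T′) + l    ∎
      where
      open ≡-Reasoning
      swapʳ : ∀ a b c → a + b + c ≡ a + c + b
      swapʳ = solve-∀

-- Enumerating trees up to isomorphism

unique⊆⇒length≤ : ∀ {A : Set} {xs ys : List A} → Unique xs → (∀ {x} → x ∈ xs → x ∈ ys) →
                  length xs ≤ length ys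
unique⊆⇒length≤ [] _ = z≤n
unique⊆⇒length≤ {xs = x ∷ xs} (x∉xs ∷ xs!) sub
  with us , vs , refl ← ∈-∃++ (sub (here refl)) =
  subst (suc (length xs) ≤_)
    (sym (trans (length-++ us) (trans (+-suc _ _) (cong suc (sym (length-++ us))))))
    (s≤s (unique⊆⇒length≤ xs! sub′))
  where
  sub′ : ∀ {y} → y ∈ xs → y ∈ us ++ vs
  sub′ y∈xs with ∈-++⁻ us (sub (there y∈xs))
  ... | inj₁ y∈us         = ∈-++⁺ˡ y∈us
  ... | inj₂ (here refl)  = contradiction refl (All.lookup x∉xs y∈xs)
  ... | inj₂ (there y∈vs) = ∈-++⁺ʳ us y∈vs

length-cartesianProduct : ∀ {A B : Set} (xs : List A) (ys : List B) →
                          length (cartesianProduct xs ys) ≡ length xs * length ys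
length-cartesianProduct []       ys = refl
length-cartesianProduct (x ∷ xs) ys =
  trans (length-++ (map (x ,_) ys)) (cong₂ _+_ (length-map (x ,_) ys) (length-cartesianProduct xs ys))

length-partition : ∀ {A : Set} {P : A → Set} (P? : Decidable P) xs →
                   length (filter P? xs) + length (filter (∁? P?) xs) ≡ length xs
length-partition P? [] = refl
length-partition P? (x ∷ xs) with does (P? x)
... | true  = cong suc (length-partition P? xs)
... | false = trans (+-suc _ _) (cong suc (length-partition P? xs))

-- All forests of total weight at most n, together with some heavier ones.
forests : ℕ → List (List Tree)
forests zero    = [] ∷ []
forests (suc n) = [] ∷ map (λ (i , us , vs) → node (suc i) us ∷ vs)
  (cartesianProduct (upTo (suc n)) (cartesianProduct (forests n) (forests n)))

∈-forests : ∀ ts n → totalWeights ts ≤ n → ts ∈ forests n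
∈-forests [] zero    _ = here refl
∈-forests [] (suc n) _ = here refl
∈-forests (node zero us ∷ vs) n _ = contradiction refl (≢-nonZero⁻¹ 0)
∈-forests (node (suc i) us ∷ vs) (suc n) (s≤s le) =
  there (∈-map⁺ _ (∈-cartesianProduct⁺ (∈-upTo⁺ (s≤s (≤-trans (m≤m+n i _) (≤-trans (m≤m+n _ _) le))))
    (∈-cartesianProduct⁺ (∈-forests us n (≤-trans (m≤n+m _ i) (≤-trans (m≤m+n _ _) le)))
                         (∈-forests vs n (≤-trans (m≤n+m _ _) le)))))

Canonical : Tree → Set
Canonical T = canon T ≡ T

assemble : ℕ × List Tree → Tree
assemble (i , us) = canon (node (suc i) us)

assembled : ℕ → List Tree
assembled n = map assemble (cartesianProduct (upTo n) (forests n))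

-- Each isomorphism class of weight `n` appears exactly once, through its canonical member.
trees : ℕ → List Tree
trees n = filter (λ T → totalWeight T ≟ n) (deduplicate _≟ᵗ_ (assembled n))

trees-unique : ∀ n → Unique (trees n)
trees-unique n = Unique.filter⁺ (λ T → totalWeight T ≟ n) (deduplicate-! (assembled n))

canon∈trees : ∀ T {n} → totalWeight T ≡ n → canon T ∈ trees n
canon∈trees (node zero us) _ = contradiction refl (≢-nonZero⁻¹ 0)
canon∈trees T@(node (suc i) us) {n} refl =
  ∈-filter⁺ (λ T → totalWeight T ≟ n)
    (∈-deduplicate⁺ _≟ᵗ_ (∈-map⁺ assemble
      (∈-cartesianProduct⁺ (∈-upTo⁺ (s≤s (m≤m+n i _))) (∈-forests us n (m≤n+m _ (suc i))))))
    (totalWeight-canon T)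

canonical∈trees : ∀ {T n} → Canonical T → totalWeight T ≡ n → T ∈ trees n
canonical∈trees {T} {n} c eq = subst (_∈ trees n) c (canon∈trees T eq)

∈-trees⁻ : ∀ {T n} → T ∈ trees n → Canonical T × totalWeight T ≡ n
∈-trees⁻ {T} {n} T∈
  with T∈′ , w ← ∈-filter⁻ (λ T → totalWeight T ≟ n) {xs = deduplicate _≟ᵗ_ (assembled n)} T∈
  with (i , us) , _ , refl ← ∈-map⁻ assemble (∈-deduplicate⁻ _≟ᵗ_ (assembled n) T∈′) =
  canon-idem (node (suc i) us) , w

-- Avoiding trees against lacking trees

mutual
  subtree-hereditarily : ∀ {P T} → Hereditarily P T → ∀ v → Hereditarily P (subtree T v)
  subtree-hereditarily p root = p
  subtree-hereditarily (node _ ps) (below i v) = subtrees-hereditarily ps i v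

  subtrees-hereditarily : ∀ {P ts} → All (Hereditarily P) ts →
                          ∀ i v → Hereditarily P (subtree (lookup ts i) v)
  subtrees-hereditarily (p ∷ _)  zero    = subtree-hereditarily p
  subtrees-hereditarily (_ ∷ ps) (suc i) = subtrees-hereditarily ps i

missing-canon : ∀ {m T} → Missing m T → Missing m (canon T)
missing-canon {m} {T} p = hereditarily (canon T) λ v eq →
  let u , eq′ = vertex-resp (canon T) T (canon-idem T) v in
  root-holds (subtree-hereditarily p u) (trans (sym eq′) eq)

module _ {P : Tree → Set} (P? : Decidable P) where
  mutual
    hereditarily? : Decidable (Hereditarily P)
    hereditarily? (node w ts) = map′ (λ (p , ps) → node p ps) (λ { (node p ps) → p , ps })
      (P? (node w ts) ×-dec hereditarilys? ts)

    hereditarilys? : Decidable (All (Hereditarily P))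
    hereditarilys? []       = yes []
    hereditarilys? (t ∷ ts) = map′ (λ (p , ps) → p ∷ ps) (λ { (p ∷ ps) → p , ps })
      (hereditarily? t ×-dec hereditarilys? ts)

missing? : ∀ m → Decidable (Missing m)
missing? m = hereditarily? (λ t → ¬? (canon t ≟ᵗ m))

module StepA (w₀ : ℕ) .{{_ : NonZero w₀}} (ls : List Tree) where
  open Marking w₀ ls
  private
    L : Tree
    L = node w₀ ls

  avoiding : ℕ → List Tree
  avoiding n = filter (∁? (hasLimb? L)) (trees n)

  lacking : ℕ → List Tree
  lacking m = filter (missing? (canon L)) (trees m)

  -- The removed piece weighs `J` + `k` with `k` < 2 `J`, which bounds `δ` and the weight of `fs` by
  -- 3 `J`. The list does not depend on the weight of the tree; its length is the constant C.
  codes : List Code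
  codes = cartesianProduct (upTo (J + J))
            (cartesianProduct (upTo (suc (J + (J + J)))) (forests (J + (J + J))))

  -- Each avoiding tree is recovered by `decode` from the code and the lacking tree that `mark`
  -- produces, so there are at most as many as pairs.
  avoiding≤codes*lacking : ∀ m → J + J ≤ m + totalWeight L →
    length (avoiding (m + totalWeight L)) ≤ length codes * length (lacking m)
  avoiding≤codes*lacking m large =
    subst (length (avoiding n) ≤_) (trans (length-map _ pairs) (length-cartesianProduct codes (lacking m)))
      (unique⊆⇒length≤ (Unique.filter⁺ (∁? (hasLimb? L)) (trees-unique n)) covered)
    where
    n = m + totalWeight L
    pairs : List (Code × Tree)
    pairs = cartesianProduct codes (lacking m)

    decode : Code × Tree → Tree
    decode (c , X) = canon (unmark c X)

    covered : ∀ {T} → T ∈ avoiding n → T ∈ map decode pairs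
    covered {T} T∈ with T∈trees , avoids ← ∈-filter⁻ (∁? (hasLimb? L)) T∈
      with canonical , refl-n ← ∈-trees⁻ T∈trees =
      subst (_∈ map decode pairs)
        (trans (Undo.canon-undo (canon (marker k)) δ fs tree) (trans (cong canon recovers) canonical))
        (∈-map⁺ decode (∈-cartesianProduct⁺
          (∈-cartesianProduct⁺ (∈-upTo⁺ k<2J) (∈-cartesianProduct⁺
            (∈-upTo⁺ (s≤s (≤-trans (m≤m+n δ _) bounded)))
            (∈-forests fs _ (≤-trans (m≤n+m _ δ) bounded))))
          (∈-filter⁺ (missing? (canon L))
            (canon∈trees tree {m} (+-cancelʳ-≡ (totalWeight L) _ _ (trans (sym weight) refl-n)))
            (missing-canon missing))))
      where
      open Marked (mark T avoids (subst (J + J ≤_) (sym refl-n) large))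
      bounded : δ + totalWeights fs ≤ J + (J + J)
      bounded = subst (_≤ J + (J + J)) (sym removed) (+-monoʳ-≤ J (<⇒≤ k<2J))

-- Trees with few distinct subtrees

mutual
  subtree-weight : ∀ T v → totalWeight (subtree T v) ≤ totalWeight T
  subtree-weight T root = ≤-refl
  subtree-weight (node w ts) (below i v) = ≤-trans (subtree-weights ts i v) (m≤n+m _ w)

  subtree-weights : ∀ ts i v → totalWeight (subtree (lookup ts i) v) ≤ totalWeights ts
  subtree-weights (t ∷ ts) zero    v = ≤-trans (subtree-weight t v) (m≤m+n _ _)
  subtree-weights (t ∷ ts) (suc i) v = ≤-trans (subtree-weights ts i v) (m≤n+m _ (totalWeight t))

children-canonical : ∀ {T} → Canonical T → All Canonical (children T)
children-canonical {node w ts} c = All.tabulate λ {t} t∈ts →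
  let u , _ , t≡u = ∈-map⁻ canon {xs = ts} (subst (t ∈_) (canons≡map ts)
                      (∈-resp-↭ (sort-↭ (canons ts)) (subst (t ∈_) (sym (cong children c)) t∈ts)))
  in trans (cong canon t≡u) (trans (canon-idem u) (sym t≡u))

subtree-canonical : ∀ T v → Canonical T → Canonical (subtree T v)
subtree-canonical T root c = c
subtree-canonical T@(node w ts) (below i v) c =
  subtree-canonical (lookup ts i) v (All.lookup (children-canonical {T} c) (∈-lookup i))

-- collect T D adds to D the distinct subtrees of T, each one in front of its own proper subtrees.
mutual
  collect : Tree → List Tree → List Tree
  collect T@(node w ts) D = if does (T ∈? D) then D else T ∷ collects ts D

  collects : List Tree → List Tree → List Tree
  collects []       D = D
  collects (t ∷ ts) D = collect t (collects ts D)

mutual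
  collect-⊇ : ∀ T {D x} → x ∈ D → x ∈ collect T D
  collect-⊇ T@(node w ts) {D} x∈D with T ∈? D
  ... | yes _ = x∈D
  ... | no  _ = there (collects-⊇ ts x∈D)

  collects-⊇ : ∀ ts {D x} → x ∈ D → x ∈ collects ts D
  collects-⊇ []       x∈D = x∈D
  collects-⊇ (t ∷ ts) x∈D = collect-⊇ t (collects-⊇ ts x∈D)

∈-collect : ∀ T D → T ∈ collect T D
∈-collect T@(node w ts) D with T ∈? D
... | yes T∈D = T∈D
... | no  _   = here refl

∈-collects : ∀ ts D → All (_∈ collects ts D) ts
∈-collects []       D = []
∈-collects (t ∷ ts) D = ∈-collect t _ ∷ All.map (collect-⊇ t) (∈-collects ts D)

mutual
  ∈-collect⁻ : ∀ T {D x} → x ∈ collect T D → x ∈ D ⊎ (∃[ v ] subtree T v ≡ x)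
  ∈-collect⁻ T@(node w ts) {D} x∈ with T ∈? D | x∈
  ... | yes _ | x∈D       = inj₁ x∈D
  ... | no  _ | here refl = inj₂ (root , refl)
  ... | no  _ | there x∈′ with ∈-collects⁻ ts x∈′
  ... | inj₁ x∈D          = inj₁ x∈D
  ... | inj₂ (i , v , eq) = inj₂ (below i v , eq)

  ∈-collects⁻ : ∀ ts {D x} → x ∈ collects ts D →
                x ∈ D ⊎ (∃[ i ] ∃[ v ] subtree (lookup ts i) v ≡ x)
  ∈-collects⁻ [] x∈D = inj₁ x∈D
  ∈-collects⁻ (t ∷ ts) x∈ with ∈-collect⁻ t x∈
  ... | inj₂ (v , eq) = inj₂ (zero , v , eq)
  ... | inj₁ x∈′ with ∈-collects⁻ ts x∈′
  ... | inj₁ x∈D          = inj₁ x∈D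
  ... | inj₂ (i , v , eq) = inj₂ (suc i , v , eq)

mutual
  -- Proper subtrees of `T` are lighter than `T`, so collecting them cannot add `T` a second time.
  collect-unique : ∀ T {D} → Unique D → Unique (collect T D)
  collect-unique T@(node w ts) {D} D! with T ∈? D
  ... | yes _  = D!
  ... | no T∉D = All.tabulate (λ x∈ T≡x → T∉ (subst (_∈ collects ts D) (sym T≡x) x∈)) ∷
                 collects-unique ts D!
    where
    T∉ : ¬ T ∈ collects ts D
    T∉ T∈ with ∈-collects⁻ ts T∈
    ... | inj₁ T∈D = T∉D T∈D
    ... | inj₂ (i , v , eq) = <-irrefl (cong totalWeight eq)
      (≤-<-trans (subtree-weights ts i v) (m<n+m _ (>-nonZero⁻¹ w)))

  collects-unique : ∀ ts {D} → Unique D → Unique (collects ts D)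
  collects-unique []       D! = D!
  collects-unique (t ∷ ts) D! = collect-unique t (collects-unique ts D!)

-- Children come later in the list than their parent, so the list can be rebuilt from its end, one
-- entry at a time.
data Closed : List Tree → Set where
  []  : Closed []
  _∷_ : ∀ {t D} → All (_∈ D) (children t) → Closed D → Closed (t ∷ D)

mutual
  collect-closed : ∀ T {D} → Closed D → Closed (collect T D)
  collect-closed T@(node w ts) {D} cl with T ∈? D
  ... | yes _ = cl
  ... | no  _ = ∈-collects ts D ∷ collects-closed ts cl

  collects-closed : ∀ ts {D} → Closed D → Closed (collects ts D)
  collects-closed []       cl = cl
  collects-closed (t ∷ ts) cl = collect-closed t (collects-closed ts cl)

tuples : ℕ → ℕ → List (List ℕ)
tuples b zero    = [] ∷ []
tuples b (suc p) = map (λ (k , ks) → k ∷ ks) (cartesianProduct (upTo (suc b)) (tuples b p))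

∈-tuples : ∀ {b ks} → All (_≤ b) ks → ks ∈ tuples b (length ks)
∈-tuples []         = here refl
∈-tuples (k≤b ∷ le) = ∈-map⁺ _ (∈-cartesianProduct⁺ (∈-upTo⁺ (s≤s k≤b)) (∈-tuples le))

length-tuples : ∀ b p → length (tuples b p) ≡ suc b ^ p
length-tuples b zero    = refl
length-tuples b (suc p) = trans (length-map _ (cartesianProduct (upTo (suc b)) (tuples b p)))
  (trans (length-cartesianProduct (upTo (suc b)) (tuples b p))
         (cong₂ _*_ (length-upTo (suc b)) (length-tuples b p)))

expand : List ℕ → List Tree → List Tree
expand (k ∷ ks) (t ∷ D) = replicate k t ++ expand ks D
expand _        _       = []

expand-0 : ∀ (D : List Tree) → expand (replicate (length D) 0) D ≡ []
expand-0 []      = refl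
expand-0 (t ∷ D) = expand-0 D

bump : ∀ {t D b} ks → t ∈ D → length ks ≡ length D → All (_≤ b) ks →
       ∃[ js ] (length js ≡ length D × All (_≤ suc b) js × expand js D ↭ t ∷ expand ks D)
bump (k ∷ ks) (here refl) eq (k≤b ∷ le) = suc k ∷ ks , eq , s≤s k≤b ∷ All.map m≤n⇒m≤1+n le , refl
bump {t} {d ∷ D} (k ∷ ks) (there t∈D) eq (k≤b ∷ le)
  with js , eq′ , le′ , p ← bump ks t∈D (suc-injective eq) le =
  k ∷ js , cong suc eq′ , m≤n⇒m≤1+n k≤b ∷ le′ ,
  ↭-trans (++⁺ˡ (replicate k d) p) (shift t (replicate k d) (expand ks D))

-- Up to order, a list of children drawn from `D` is a table of multiplicities; this is what makes
-- each entry of a closed list cheap to describe.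
multiplicities : ∀ {D} ts → All (_∈ D) ts →
                 ∃[ ks ] (length ks ≡ length D × All (_≤ length ts) ks × expand ks D ↭ ts)
multiplicities {D} [] [] =
  replicate (length D) 0 , length-replicate (length D) , All.replicate⁺ (length D) z≤n ,
  ↭-reflexive (expand-0 D)
multiplicities (t ∷ ts) (t∈D ∷ ts∈D)
  with ks , eq , le , p ← multiplicities ts ts∈D
  with js , eq′ , le′ , q ← bump ks t∈D eq le = js , eq′ , le′ , ↭-trans q (prep t p)

-- The possible values of collect T [] of length p: each entry is determined by its root weight and
-- by how often each of the later entries occurs among its children.
layer : ℕ × List ℕ × List Tree → List Tree
layer (i , ks , D) = canon (node (suc i) (expand ks D)) ∷ D

closedLists : ℕ → ℕ → List (List Tree)
closedLists m zero    = [] ∷ []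
closedLists m (suc p) =
  map layer (cartesianProduct (upTo m) (cartesianProduct (tuples m p) (closedLists m p)))

length≤totalWeights : ∀ ts → length ts ≤ totalWeights ts
length≤totalWeights [] = z≤n
length≤totalWeights (node w us ∷ ts) =
  +-mono-≤ (≤-trans (>-nonZero⁻¹ w) (m≤m+n w _)) (length≤totalWeights ts)

∈-closedLists : ∀ {m D} → Closed D → All Canonical D → All (λ t → totalWeight t ≤ m) D →
                D ∈ closedLists m (length D)
∈-closedLists [] [] [] = here refl
∈-closedLists {D = node zero us ∷ _} _ _ _ = contradiction refl (≢-nonZero⁻¹ 0)
∈-closedLists {m} {t@(node (suc i) ts) ∷ D} (ts∈D ∷ cl) (canonical ∷ cs) (t≤m ∷ le)
  with ks , eq , ks≤ , p ← multiplicities ts ts∈D =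
  subst (λ s → s ∷ D ∈ closedLists m (suc (length D))) (trans (canon-node (canons-↭ p)) canonical)
    (∈-map⁺ layer (∈-cartesianProduct⁺ (∈-upTo⁺ (≤-trans (s≤s (m≤m+n i _)) t≤m))
      (∈-cartesianProduct⁺
        (subst (λ p → ks ∈ tuples m p) eq (∈-tuples (All.map (λ k≤ → ≤-trans k≤ ts≤m) ks≤)))
        (∈-closedLists cl cs le))))
  where
  ts≤m : length ts ≤ m
  ts≤m = ≤-trans (length≤totalWeights ts) (≤-trans (m≤n+m _ (suc i)) t≤m)

-- A new entry in front of `p` others has `m` possible root weights and (m+1)^p multiplicity tables.
-- The exponent p² absorbs this because 1 + p + p² ≤ (p+1)².
length-closedLists : ∀ m p → length (closedLists m p) ≤ suc m ^ (p * p)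
length-closedLists m zero = ≤-refl
length-closedLists m (suc p) = begin
  length (closedLists m (suc p))
    ≡⟨ length-map layer (cartesianProduct (upTo m) (cartesianProduct (tuples m p) (closedLists m p))) ⟩
  length (cartesianProduct (upTo m) (cartesianProduct (tuples m p) (closedLists m p)))
    ≡⟨ length-cartesianProduct (upTo m) _ ⟩
  length (upTo m) * length (cartesianProduct (tuples m p) (closedLists m p))
    ≡⟨ cong₂ _*_ (length-upTo m) (length-cartesianProduct (tuples m p) (closedLists m p)) ⟩
  m * (length (tuples m p) * length (closedLists m p))
    ≡⟨ cong (λ x → m * (x * length (closedLists m p))) (length-tuples m p) ⟩
  m * (suc m ^ p * length (closedLists m p))
    ≤⟨ *-mono-≤ (n≤1+n m) (*-monoʳ-≤ (suc m ^ p) (length-closedLists m p)) ⟩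
  suc m * (suc m ^ p * suc m ^ (p * p))
    ≡⟨ cong (suc m *_) (^-distribˡ-+-* (suc m) p (p * p)) ⟨
  suc m ^ suc (p + p * p)
    ≤⟨ ^-monoʳ-≤ (suc m) (s≤s (+-monoʳ-≤ p (*-monoʳ-≤ p (n≤1+n p)))) ⟩
  suc m ^ (suc p * suc p) ∎
  where open ≤-Reasoning

-- The default for the empty list is arbitrary: it can only enlarge `simple`, which serves as an
-- upper bound.
first : List Tree → Tree
first []      = node 1 []
first (t ∷ _) = t

simple : ℕ → ℕ → List Tree
simple m zero    = []
simple m (suc K) = map first (closedLists m K) ++ simple m K

length-simple : ∀ m K → length (simple m K) ≤ K * suc m ^ (K * K)
length-simple m zero = z≤n
length-simple m (suc K) = begin
  length (simple m (suc K))
    ≡⟨ length-++ (map first (closedLists m K)) ⟩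
  length (map first (closedLists m K)) + length (simple m K)
    ≡⟨ cong (_+ length (simple m K)) (length-map first (closedLists m K)) ⟩
  length (closedLists m K) + length (simple m K)
    ≤⟨ +-mono-≤ (length-closedLists m K) (length-simple m K) ⟩
  suc K * suc m ^ (K * K)
    ≤⟨ *-monoʳ-≤ (suc K) (^-monoʳ-≤ (suc m) (*-mono-≤ (n≤1+n K) (n≤1+n K))) ⟩
  suc K * suc m ^ (suc K * suc K) ∎
  where open ≤-Reasoning

∈-simple : ∀ {m K p D} → p < K → D ∈ closedLists m p → first D ∈ simple m K
∈-simple {m} {suc K} {p} p<1+K D∈ with p ≟ K
... | yes refl = ∈-++⁺ˡ (∈-map⁺ first D∈)
... | no p≢K = ∈-++⁺ʳ (map first (closedLists m K)) (∈-simple (≤∧≢⇒< (s≤s⁻¹ p<1+K) p≢K) D∈)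

-- `collect T []` is a closed list with `T` at its head, so `first` recovers `T`.
canonical∈simple : ∀ {T m K} → Canonical T → totalWeight T ≡ m → length (collect T []) < K →
                   T ∈ simple m K
canonical∈simple {T@(node w ts)} {m} canonical refl few =
  ∈-simple {D = collect T []} few (∈-closedLists (collect-closed T []) (All.tabulate λ x∈ → proj₁ (good x∈))
                 (All.tabulate λ x∈ → proj₂ (good x∈)))
  where
  good : ∀ {x} → x ∈ collect T [] → Canonical x × totalWeight x ≤ m
  good x∈ with ∈-collect⁻ T {[]} x∈
  ... | inj₁ ()
  ... | inj₂ (v , refl) = subtree-canonical T v canonical , subtree-weight T v

-- Grafting L onto lacking trees

module _ {A B : Set} (f : A → List B) where
  length-concatMap-const : ∀ {k xs} → All (λ x → length (f x) ≡ k) xs →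
                           length (concatMap f xs) ≡ length xs * k
  length-concatMap-const [] = refl
  length-concatMap-const (_∷_ {x} eq eqs) =
    trans (length-++ (f x)) (cong₂ _+_ eq (length-concatMap-const eqs))

  ∈-concatMap⁻ : ∀ {y} xs → y ∈ concatMap f xs → ∃[ x ] (x ∈ xs × y ∈ f x)
  ∈-concatMap⁻ (x ∷ xs) y∈ with ∈-++⁻ (f x) y∈
  ... | inj₁ y∈fx = x , here refl , y∈fx
  ... | inj₂ y∈′ with x′ , x′∈ , y∈fx′ ← ∈-concatMap⁻ xs y∈′ = x′ , there x′∈ , y∈fx′

  concatMap-unique : ∀ {xs} → Unique xs → (∀ x → Unique (f x)) →
                     (∀ {x x′ y} → y ∈ f x → y ∈ f x′ → x ≡ x′) → Unique (concatMap f xs)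
  concatMap-unique [] _ _ = []
  concatMap-unique {x ∷ xs} (x∉xs ∷ xs!) f! sep =
    Unique.++⁺ (f! x) (concatMap-unique xs! f! sep) λ (y∈fx , y∈) →
      let x′ , x′∈ , y∈fx′ = ∈-concatMap⁻ xs y∈ in All.lookup x∉xs x′∈ (sep y∈fx y∈fx′)

module StepB (w₀ : ℕ) .{{_ : NonZero w₀}} (ls : List Tree) where
  open StepA w₀ ls
  private
    L m₀ : Tree
    L = node w₀ ls
    m₀ = canon L
  -- The graft replaces nothing, so undoing it only deletes the copy of `L`.
  open Undo m₀ 0 []

  graft : Tree → Tree
  graft (node w ts) = node w (L ∷ ts)

  undo-graft : ∀ {S} → Missing m₀ S → undo (graft S) ≡ S
  undo-graft {node w ts} (node _ ps) =
    trans (undo-marker refl ps) (node-cong {{nonZero-+ w 0}} (+-identityʳ w) refl)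

  hosts-graft : ∀ {S} → Missing m₀ S → hosts m₀ (graft S) ≡ [ canon (graft S) ]
  hosts-graft {node w ts} (node _ ps) = hosts-marker m₀ refl ps

  module _ {T : Tree} (missing : Missing m₀ T) (v : Vertex T) where
    private
      S = subtree T v

    grafted : Tree
    grafted = proj₁ (replaceAt v (graft S))

    private
      replaced : Replace S (graft S) T grafted
      replaced = proj₂ (replaceAt v (graft S))

      m₀<graft : ∀ S → totalWeight m₀ < totalWeight (graft S)
      m₀<graft (node w ts) = subst (_< totalWeight (node w (L ∷ ts))) (sym (totalWeight-canon L))
        (<-≤-trans (m<n+m _ (>-nonZero⁻¹ w)) (+-monoʳ-≤ w (m≤m+n _ _)))

    undo-grafted : undo grafted ≡ T
    undo-grafted = undo-replace replaced (m₀<graft S) undo-graft missing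

    hosts-grafted : hosts m₀ grafted ≡ [ canon (graft S) ]
    hosts-grafted = hosts-replace m₀ replaced (m₀<graft S) hosts-graft missing

    grafted-weight : totalWeight grafted ≡ totalWeight T + totalWeight L
    grafted-weight with c , eq , eq′ ← replace-weight replaced = begin
      totalWeight grafted                   ≡⟨ eq′ ⟩
      totalWeight (graft S) + c             ≡⟨ cong (_+ c) (graft-weight S) ⟩
      totalWeight S + totalWeight L + c     ≡⟨ +-assoc (totalWeight S) _ c ⟩
      totalWeight S + (totalWeight L + c)   ≡⟨ cong (totalWeight S +_) (+-comm (totalWeight L) c) ⟩
      totalWeight S + (c + totalWeight L)   ≡⟨ +-assoc (totalWeight S) c _ ⟨
      totalWeight S + c + totalWeight L     ≡⟨ cong (_+ totalWeight L) eq ⟨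
      totalWeight T + totalWeight L         ∎
      where
      open ≡-Reasoning
      graft-weight : ∀ S → totalWeight (graft S) ≡ totalWeight S + totalWeight L
      graft-weight (node w ts) =
        trans (cong (w +_) (+-comm (totalWeight L) (totalWeights ts))) (sym (+-assoc w _ _))

  -- Reads off a grafted tree the original tree and the subtree at the grafting site. Distinct such
  -- pairs therefore come from non-isomorphic grafted trees.
  observe : Tree → Tree × List Tree
  observe X = canon (undo X) , map (canon ∘ undo) (hosts m₀ X)

  observe-grafted : ∀ {T} → Canonical T → (missing : Missing m₀ T) → ∀ v →
                    observe (canon (grafted missing v)) ≡ (T , [ subtree T v ])
  observe-grafted {T} canonical missing v = cong₂ _,_
    (trans (canon-undo X) (trans (cong canon (undo-grafted missing v)) canonical))
    (trans (cong (map (canon ∘ undo)) hosts≡)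
           (cong [_] (trans (canon-undo (graft S))
             (trans (cong canon (undo-graft S-missing)) (subtree-canonical T v canonical)))))
    where
    S = subtree T v
    X = grafted missing v
    hosts≡ : hosts m₀ (canon X) ≡ [ canon (graft S) ]
    hosts≡ = ↭-singleton-inv (↭-trans (hosts-canon m₀ X) (↭-reflexive (hosts-grafted missing v)))
    S-missing : Missing m₀ S
    S-missing = subtree-hereditarily missing v

  module _ (K m : ℕ) where
    private
      n : ℕ
      n = m + totalWeight L

      rich? : ∀ T → Dec (K ≤ length (collect T []))
      rich? T = K ≤? length (collect T [])

      rich poor : List Tree
      rich = filter rich? (lacking m)
      poor = filter (∁? rich?) (lacking m)

      sites : Tree → List (Tree × List Tree)
      sites T = map (λ c → T , [ c ]) (take K (collect T []))

      ∈-lacking⁻ : ∀ {T} → T ∈ lacking m → Canonical T × totalWeight T ≡ m × Missing m₀ T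
      ∈-lacking⁻ T∈ with T∈trees , missing ← ∈-filter⁻ (missing? m₀) {xs = trees m} T∈
        with canonical , weight ← ∈-trees⁻ T∈trees = canonical , weight , missing

      lacking-unique : Unique (lacking m)
      lacking-unique = Unique.filter⁺ (missing? m₀) (trees-unique m)

      length-sites : ∀ {T} → T ∈ rich → length (sites T) ≡ K
      length-sites {T} T∈ with _ , K≤ ← ∈-filter⁻ rich? {xs = lacking m} T∈ =
        trans (length-map _ (take K (collect T [])))
              (trans (length-take K (collect T [])) (m≤n⇒m⊓n≡m K≤))

      sites-unique : Unique (concatMap sites rich)
      sites-unique = concatMap-unique sites (Unique.filter⁺ rich? lacking-unique)
        (λ T → Unique.map⁺ (∷-injectiveˡ ∘ ,-injectiveʳ) (Unique.take⁺ K (collect-unique T [])))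
        (λ {T} {T′} y∈ y∈′ → same-tree T T′ (∈-map⁻ _ y∈) (∈-map⁻ _ y∈′))
        where
        same-tree : ∀ T T′ {y} {cs cs′ : List Tree} → ∃[ c ] (c ∈ cs × y ≡ (T , [ c ])) →
                    ∃[ c ] (c ∈ cs′ × y ≡ (T′ , [ c ])) → T ≡ T′
        same-tree T T′ (_ , _ , refl) (_ , _ , eq) = ,-injectiveˡ eq

      ∈-take⁻ : ∀ {A : Set} k {x : A} {xs} → x ∈ take k xs → x ∈ xs
      ∈-take⁻ (suc k) {xs = _ ∷ _} (here eq)  = here eq
      ∈-take⁻ (suc k) {xs = _ ∷ _} (there x∈) = there (∈-take⁻ k x∈)

      sites-observed : ∀ {y} → y ∈ concatMap sites rich → y ∈ map observe (trees n)
      sites-observed {y} y∈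
        with T , T∈rich , y∈T ← ∈-concatMap⁻ sites rich y∈
        with c , c∈ , refl ← ∈-map⁻ (λ c → T , [ c ]) y∈T
        with T∈ , _ ← ∈-filter⁻ rich? {xs = lacking m} T∈rich
        with canonical , refl , missing ← ∈-lacking⁻ T∈
        with ∈-collect⁻ T {[]} (∈-take⁻ K c∈)
      ... | inj₂ (v , refl) = subst (_∈ map observe (trees n)) (observe-grafted canonical missing v)
        (∈-map⁺ observe (canon∈trees (grafted missing v) (grafted-weight missing v)))

      K*rich≤trees : length rich * K ≤ length (trees n)
      K*rich≤trees = begin
        length rich * K                 ≡⟨ length-concatMap-const sites (All.tabulate length-sites) ⟨
        length (concatMap sites rich)   ≤⟨ unique⊆⇒length≤ sites-unique sites-observed ⟩
        length (map observe (trees n))  ≡⟨ length-map observe (trees n) ⟩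
        length (trees n)                ∎
        where open ≤-Reasoning

      poor≤simple : length poor ≤ length (simple m K)
      poor≤simple = unique⊆⇒length≤ (Unique.filter⁺ (∁? rich?) lacking-unique) λ T∈ →
        let T∈lacking , ¬rich = ∈-filter⁻ (∁? rich?) {xs = lacking m} T∈
            canonical , weight , _ = ∈-lacking⁻ T∈lacking
        in canonical∈simple canonical weight (≰⇒> ¬rich)

    -- A rich tree accounts for `K` observations on trees of weight `n`, and no observation is
    -- shared by two trees; the poor trees are bounded by `simple`.
    lacking*K≤ : length (lacking m) * K ≤ length (trees n) + K * suc m ^ (K * K) * K
    lacking*K≤ = begin
      length (lacking m) * K              ≡⟨ cong (_* K) (length-partition rich? (lacking m)) ⟨
      (length rich + length poor) * K     ≡⟨ *-distribʳ-+ K (length rich) (length poor) ⟩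
      length rich * K + length poor * K   ≤⟨ +-mono-≤ K*rich≤trees
                                               (*-monoˡ-≤ K (≤-trans poor≤simple (length-simple m K))) ⟩
      length (trees n) + K * suc m ^ (K * K) * K ∎
      where open ≤-Reasoning

-- Exponential growth of the number of trees

grow : Tree → Tree
grow (node w ts) = node (suc w) ts

stem : Tree → Tree
stem t = node 1 [ t ]

-- `grow` and `stem` are injective, preserve canonicity and add 1 to the weight. Their images are
-- disjoint, with root weight at least 2 in one and equal to 1 in the other.
trees-double : ∀ n → length (trees n) + length (trees n) ≤ length (trees (suc n))
trees-double n = begin
  length (trees n) + length (trees n)
    ≡⟨ cong₂ _+_ (length-map grow (trees n)) (length-map stem (trees n)) ⟨
  length (map grow (trees n)) + length (map stem (trees n))
    ≡⟨ length-++ (map grow (trees n)) ⟨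
  length (map grow (trees n) ++ map stem (trees n))
    ≤⟨ unique⊆⇒length≤ unique included ⟩
  length (trees (suc n)) ∎
  where
  open ≤-Reasoning

  grow-injective : ∀ {s t} → grow s ≡ grow t → s ≡ t
  grow-injective {node _ _} {node _ _} eq =
    node-cong (suc-injective (cong rootWeight eq)) (cong children eq)

  stem-injective : ∀ {s t} → stem s ≡ stem t → s ≡ t
  stem-injective refl = refl

  grow≢stem : ∀ s {t} → grow s ≢ stem t
  grow≢stem (node w _) eq = ≢-nonZero⁻¹ w (suc-injective (cong rootWeight eq))

  unique : Unique (map grow (trees n) ++ map stem (trees n))
  unique = Unique.++⁺ (Unique.map⁺ grow-injective (trees-unique n))
                      (Unique.map⁺ stem-injective (trees-unique n)) λ (x∈ , x∈′) →
    let s , _ , eq = ∈-map⁻ grow x∈ ; t , _ , eq′ = ∈-map⁻ stem x∈′ in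
    grow≢stem s (trans (sym eq) eq′)

  grow-canonical : ∀ {t} → Canonical t → Canonical (grow t)
  grow-canonical {node _ _} c = node-cong refl (cong children c)

  grow-weight : ∀ t → totalWeight (grow t) ≡ suc (totalWeight t)
  grow-weight (node _ _) = refl

  included : ∀ {x} → x ∈ map grow (trees n) ++ map stem (trees n) → x ∈ trees (suc n)
  included x∈ with ∈-++⁻ (map grow (trees n)) x∈
  ... | inj₁ x∈g with t , t∈ , refl ← ∈-map⁻ grow x∈g with c , refl ← ∈-trees⁻ {t} {n} t∈ =
    canonical∈trees (grow-canonical c) (grow-weight t)
  ... | inj₂ x∈s with t , t∈ , refl ← ∈-map⁻ stem x∈s with c , refl ← ∈-trees⁻ {t} {n} t∈ =
    canonical∈trees (node-cong refl (trans (sort-singleton (canon t)) (cong [_] c)))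
                    (cong suc (+-identityʳ _))

2^n≤trees : ∀ n → 2 ^ n ≤ length (trees (suc n))
2^n≤trees zero = ∈-length (canon∈trees (node 1 []) refl)
2^n≤trees (suc n) = ≤-trans
  (≤-trans (≤-reflexive (cong (_+_ (2 ^ n)) (+-identityʳ (2 ^ n)))) (+-mono-≤ (2^n≤trees n) (2^n≤trees n)))
  (trees-double (suc n))

n<2^n : ∀ n → n < 2 ^ n
n<2^n zero = s≤s z≤n
n<2^n (suc n) = begin-strict
  suc n           <⟨ s≤s (n<2^n n) ⟩
  1 + 2 ^ n       ≤⟨ +-monoˡ-≤ (2 ^ n) (>-nonZero⁻¹ (2 ^ n) {{m^n≢0 2 n}}) ⟩
  2 ^ n + 2 ^ n   ≡⟨ cong (_+_ (2 ^ n)) (+-identityʳ (2 ^ n)) ⟨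
  2 ^ suc n       ∎
  where open ≤-Reasoning

^-distribʳ-* : ∀ m n k → (m * n) ^ k ≡ m ^ k * n ^ k
^-distribʳ-* m n zero    = refl
^-distribʳ-* m n (suc k) =
  trans (cong (m * n *_) (^-distribʳ-* m n k)) (interchange m n (m ^ k) (n ^ k))
  where
  interchange : ∀ a b c d → a * b * (c * d) ≡ a * c * (b * d)
  interchange = solve-∀

-- Put e = d + 1 and q = ⌊n/e⌋. Then n + 1 ≤ (q+1) e ≤ 2^q e, so the left side is at most A e^d
-- 2^(qd). For q ≥ A e^d this is at most 2^q 2^(qd) = 2^(qe) ≤ 2^n.
exponential-dominates : ∀ A d → ∃[ N ] (∀ n → n ≥ N → A * suc n ^ d ≤ 2 ^ n)
exponential-dominates A d = A * e ^ d * e , bound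
  where
  e = suc d
  bound : ∀ n → n ≥ A * e ^ d * e → A * suc n ^ d ≤ 2 ^ n
  bound n n≥N = begin
    A * suc n ^ d                      ≤⟨ *-monoʳ-≤ A (^-monoˡ-≤ d 1+n≤) ⟩
    A * (2 ^ q * e) ^ d                ≡⟨ cong (A *_) (^-distribʳ-* (2 ^ q) e d) ⟩
    A * ((2 ^ q) ^ d * e ^ d)          ≡⟨ regroup A ((2 ^ q) ^ d) (e ^ d) ⟩
    A * e ^ d * (2 ^ q) ^ d            ≤⟨ *-monoˡ-≤ ((2 ^ q) ^ d) (≤-trans q≥ (<⇒≤ (n<2^n q))) ⟩
    (2 ^ q) ^ e                        ≡⟨ ^-*-assoc 2 q e ⟩
    2 ^ (q * e)                        ≤⟨ ^-monoʳ-≤ 2 (≤-trans (m≤n+m _ (n ℕ.% e)) (≤-reflexive (sym n≡))) ⟩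
    2 ^ n                              ∎
    where
    open ≤-Reasoning
    q = n ℕ./ e
    regroup : ∀ a x y → a * (x * y) ≡ a * y * x
    regroup = solve-∀
    n≡ : n ≡ n ℕ.% e + q * e
    n≡ = m≡m%n+[m/n]*n n e
    q≥ : A * e ^ d ≤ q
    q≥ = subst (_≤ q) (m*n/n≡m (A * e ^ d) e) (/-monoˡ-≤ e n≥N)
    1+n≤ : suc n ≤ 2 ^ q * e
    1+n≤ = begin
      suc n                        ≡⟨ cong suc n≡ ⟩
      suc (n ℕ.% e) + q * e        ≤⟨ +-monoˡ-≤ (q * e) (m%n<n n e) ⟩
      suc q * e                    ≤⟨ *-monoˡ-≤ e (n<2^n q) ⟩
      2 ^ q * e                    ∎

-- Avoiding trees are rare

module _ (w₀ : ℕ) .{{_ : NonZero w₀}} (ls : List Tree) where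
  open Marking w₀ ls using (J)
  open StepA w₀ ls
  open StepB w₀ ls
  private
    l C : ℕ
    l = totalWeight (node w₀ ls)
    C = length codes

  avoiding-bound : ∀ K n → n ≥ J + J + l →
    length (avoiding n) * K ≤ C * length (trees n) + C * K * K * suc n ^ (K * K)
  avoiding-bound K n n≥ = begin
    length (avoiding n) * K
      ≡⟨ cong (λ x → length (avoiding x) * K) n≡ ⟩
    length (avoiding (m + l)) * K
      ≤⟨ *-monoˡ-≤ K (avoiding≤codes*lacking m (≤-trans (m≤m+n (J + J) l) (subst (J + J + l ≤_) n≡ n≥))) ⟩
    C * length (lacking m) * K
      ≡⟨ *-assoc C (length (lacking m)) K ⟩
    C * (length (lacking m) * K)
      ≤⟨ *-monoʳ-≤ C (lacking*K≤ K m) ⟩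
    C * (length (trees (m + l)) + K * suc m ^ (K * K) * K)
      ≡⟨ cong (λ x → C * (length (trees x) + K * suc m ^ (K * K) * K)) n≡ ⟨
    C * (length (trees n) + K * suc m ^ (K * K) * K)
      ≡⟨ regroup C (length (trees n)) K (suc m ^ (K * K)) ⟩
    C * length (trees n) + C * K * K * suc m ^ (K * K)
      ≤⟨ +-monoʳ-≤ (C * length (trees n))
           (*-monoʳ-≤ (C * K * K) (^-monoˡ-≤ (K * K) (s≤s (m∸n≤m n l)))) ⟩
    C * length (trees n) + C * K * K * suc n ^ (K * K) ∎
    where
    open ≤-Reasoning
    m = n ∸ l
    n≡ : n ≡ m + l
    n≡ = sym (m∸n+n≡m (≤-trans (m≤n+m l (J + J)) n≥))
    regroup : ∀ c t k p → c * (t + k * p * k) ≡ c * t + c * k * k * p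
    regroup = solve-∀

  avoiding-rare : ∀ q → ∃[ N ] (∀ n → n ≥ N → length (avoiding n) * q < length (trees n))
  avoiding-rare q = (J + J + l) ⊔ N , λ n n≥ →
    rare n (≤-trans (m≤m⊔n _ N) n≥) (≤-trans (m≤n⊔m (J + J + l) N) n≥)
    where
    -- The factor C + 1 cancels against the bound (C+1) t, leaving a (q+1) ≤ t.
    K = suc C * suc q
    -- The factor 2 makes up for having only 2^(n-1) trees of weight `n` guaranteed.
    A = 2 * (C * K * K)
    N = proj₁ (exponential-dominates A (K * K))

    rare : ∀ n → n ≥ J + J + l → n ≥ N → length (avoiding n) * q < length (trees n)
    rare n@(suc n-1) n≥ n≥N = improve (length (avoiding n))
      (*-cancelˡ-≤ (suc C) (begin
        suc C * (a * suc q)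
          ≡⟨ regroup (suc C) a (suc q) ⟩
        a * K
          ≤⟨ avoiding-bound K n n≥ ⟩
        C * t + C * K * K * suc n ^ (K * K)
          ≤⟨ +-monoʳ-≤ (C * t) (*-cancelˡ-≤ 2 (≤-trans (≤-reflexive (sym (*-assoc 2 (C * K * K) _)))
               (≤-trans (proj₂ (exponential-dominates A (K * K)) n n≥N) (*-monoʳ-≤ 2 (2^n≤trees n-1))))) ⟩
        C * t + t
          ≡⟨ +-comm (C * t) t ⟩
        suc C * t ∎))
      where
      open ≤-Reasoning
      a = length (avoiding n)
      t = length (trees n)
      regroup : ∀ c a q → c * (a * q) ≡ a * (c * q)
      regroup = solve-∀
      0<t : 0 < t
      0<t = ≤-trans (>-nonZero⁻¹ (2 ^ n-1) {{m^n≢0 2 n-1}}) (2^n≤trees n-1)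
      -- Passing from q + 1 to q gives strictness when `a` is positive; for `a` = 0 it comes from
      -- the existence of a tree.
      improve : ∀ a → a * suc q ≤ t → a * q < t
      improve zero    _  = 0<t
      improve (suc a) le = <-≤-trans (*-monoʳ-< (suc a) (n<1+n q)) le

-- Counts up to isomorphism and the limit

countUpToIso : ∀ {P : Tree → Set} {ts} → Unique ts → All Canonical ts → All P ts →
               (∀ T → P T → canon T ∈ ts) → CountUpToIso P (length ts)
countUpToIso {P} {ts} ts! canonical satisfy complete = record
  { representatives = ts
  ; satisfy         = satisfy
  ; non-isomorphic  = distinct canonical ts!
  ; exhaustive      = λ T p → Any.map
      (λ {S} eq → canon≡⇒≅ T S (trans (sym (canon-idem T)) (cong canon eq))) (complete T p)
  ; number          = refl
  }
  where
  distinct : ∀ {ts} → All Canonical ts → Unique ts → AllPairs (λ S T → ¬ (S ≅ T)) ts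
  distinct [] [] = []
  distinct {t ∷ ts} (c ∷ cs) (t∉ts ∷ ts!) =
    All.tabulate (λ {s} s∈ t≅s → All.lookup t∉ts s∈
      (trans (sym c) (trans (≅⇒canon≡ t s t≅s) (All.lookup cs s∈)))) ∷
    distinct cs ts!

count-trees : ∀ n → CountUpToIso (λ T → totalWeight T ≡ n) (length (trees n))
count-trees n = countUpToIso (trees-unique n)
  (All.tabulate λ T∈ → proj₁ (∈-trees⁻ {n = n} T∈)) (All.tabulate λ T∈ → proj₂ (∈-trees⁻ {n = n} T∈))
  (λ T weight → canon∈trees T weight)

count-filter : ∀ {P : Tree → Set} (P? : Decidable P) →
               (∀ {S T} → canon S ≡ canon T → P S → P T) → ∀ n →
               CountUpToIso (λ T → totalWeight T ≡ n × P T) (length (filter P? (trees n)))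
count-filter {P} P? resp n = countUpToIso (Unique.filter⁺ P? (trees-unique n))
  (All.tabulate λ T∈ → let T∈trees , _ = ∈-filter⁻ P? {xs = trees n} T∈ in
    proj₁ (∈-trees⁻ {n = n} T∈trees))
  (All.tabulate λ T∈ → let T∈trees , p = ∈-filter⁻ P? {xs = trees n} T∈ in
    proj₂ (∈-trees⁻ {n = n} T∈trees) , p)
  (λ T (weight , p) → ∈-filter⁺ P? (canon∈trees T weight) (resp (sym (canon-idem T)) p))

module _ (a b t-1 : ℕ) (a+b≡t : a + b ≡ suc t-1) where
  private
    t = suc t-1
    p = ℚ._/_ (ℤ.+ a) t
    r = ℚ._/_ (ℤ.+ b) t

  open ℚᵘ.≃-Reasoning

  p+r≡1 : p ℚ.+ r ≡ 1ℚ
  p+r≡1 = ℚ.toℚᵘ-injective (begin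
    ℚ.toℚᵘ (p ℚ.+ r)                     ≈⟨ ℚ.toℚᵘ-homo-+ p r ⟩
    ℚ.toℚᵘ p ℚᵘ.+ ℚ.toℚᵘ r               ≈⟨ ℚᵘ.+-cong (ℚ.toℚᵘ-fromℚᵘ (mkℚᵘ (ℤ.+ a) t-1)) (ℚ.toℚᵘ-fromℚᵘ (mkℚᵘ (ℤ.+ b) t-1)) ⟩
    mkℚᵘ (ℤ.+ a) t-1 ℚᵘ.+ mkℚᵘ (ℤ.+ b) t-1   ≈⟨ *≡* numerators ⟩
    ℚᵘ.1ℚᵘ                               ∎)
    where
    numerators : ((ℤ.+ a) ℤ.* (ℤ.+ t) ℤ.+ (ℤ.+ b) ℤ.* (ℤ.+ t)) ℤ.* (ℤ.+ 1) ≡ (ℤ.+ 1) ℤ.* (ℤ.+ (t * t))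
    numerators = trans (ℤ.*-identityʳ _) (trans (sym (ℤ.*-distribʳ-+ (ℤ.+ t) (ℤ.+ a) (ℤ.+ b)))
      (trans (cong (λ x → ℤ.+ x ℤ.* ℤ.+ t) a+b≡t) (trans (sym (ℤ.pos-* t t)) (sym (ℤ.*-identityˡ _)))))

  ∣p-1∣≡r : ℚ.∣ p ℚ.- 1ℚ ∣ ≡ r
  ∣p-1∣≡r = trans (cong ℚ.∣_∣ p-1≡-r) (trans (ℚ.∣-p∣≡∣p∣ r) (ℚ.0≤p⇒∣p∣≡p (ℚ.nonNegative⁻¹ r {{ℚ.normalize-nonNeg b t}})))
    where
    p-1≡-r : p ℚ.- 1ℚ ≡ ℚ.- r
    p-1≡-r = trans (cong (λ x → p ℚ.- x) (sym p+r≡1)) (trans (cong (p ℚ.+_) (ℚ.neg-distrib-+ p r))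
      (trans (sym (ℚ.+-assoc p (ℚ.- p) (ℚ.- r))) (trans (cong (ℚ._+ (ℚ.- r)) (ℚ.+-inverseʳ p)) (ℚ.+-identityˡ (ℚ.- r)))))

  r<ε : ∀ ε → 0ℚ ℚ.< ε → b * ℚ.↧ₙ ε < t → r ℚ.< ε
  r<ε (mkℚ (ℤ.+ zero) _ _) (ℚ.*<* (ℤ.+<+ ()))
  r<ε (mkℚ (ℤ.-[1+ _ ]) _ _) (ℚ.*<* ())
  r<ε (mkℚ (ℤ.+ suc k) d-1 c) _ b*d<t = ℚ.toℚᵘ-cancel-<
    (ℚᵘ.<-respˡ-≃ (ℚᵘ.≃-sym (ℚ.toℚᵘ-fromℚᵘ (mkℚᵘ (ℤ.+ b) t-1)))
      (*<* (subst₂ ℤ._<_ (ℤ.pos-* b (suc d-1)) (ℤ.pos-* (suc k) t)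
        (ℤ.+<+ (<-≤-trans b*d<t (m≤m+n t (k * t)))))))

corollary2p5 : (L : Tree) →
    Σ[ total ∈ (ℕ → ℕ) ] Σ[ withLimb ∈ (ℕ → ℕ) ]
    ((∀ n → CountUpToIso (λ T → totalWeight T ≡ n) (total n))
    × (∀ n → CountUpToIso (λ T → totalWeight T ≡ n × HasLimb T L) (withLimb n))
    × RatioTendsTo withLimb total 1ℚ)
corollary2p5 L@(node w₀ ls) =
  (λ n → length (trees n)) , (λ n → length (filter (hasLimb? L) (trees n))) ,
  count-trees , count-filter (hasLimb? L) hasLimb-resp , λ ε 0<ε →
  let N , rare = avoiding-rare w₀ ls (ℚ.↧ₙ ε) in N , λ n n≥N →
  close (length (filter (hasLimb? L) (trees n))) (length (avoiding n)) (length (trees n))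
    (length-partition (hasLimb? L) (trees n)) ε 0<ε (rare n n≥N)
  where
  open StepA w₀ ls using (avoiding)

  close : ∀ a b t → a + b ≡ t → ∀ ε → 0ℚ ℚ.< ε → b * ℚ.↧ₙ ε < t →
          Σ[ t≢0 ∈ NonZero t ] ℚ.∣ ℚ._/_ (ℤ.+ a) t {{t≢0}} ℚ.- 1ℚ ∣ ℚ.< ε
  close a b (suc t-1) eq ε 0<ε lt =
    _ , subst (ℚ._< ε) (sym (∣p-1∣≡r a b t-1 eq)) (r<ε a b t-1 eq ε 0<ε lt)
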